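{- Let $\Sigma,\Sigma'$ be disjoint signatures and let $\mathcal{U},\mathcal{U}'$ be continuous quantitative equational theories of type $\Sigma$ and $\Sigma'$ respectively. Then the monad $\mathbb{C}T_{\mathcal{U}+\mathcal{U}'}$ on $\mathbf{CMet}$ is isomorphic to the sum $\mathbb{C}T_{\mathcal{U}}+\mathbb{C}T_{\mathcal{U}'}$, i.e. to the coproduct of $\mathbb{C}T_{\mathcal{U}}$ and $\mathbb{C}T_{\mathcal{U}'}$ in the category of monads on $\mathbf{CMet}$ and monad maps.
   Context: An extended metric space is a set $X$ with $d_X:X\times X\to[0,\infty]$ satisfying $d_X(x,y)=0$ iff $x=y$, symmetry and the triangle inequality. $\mathbf{Met}$ is the category of extended metric spaces and non-expansive maps; $\mathbf{CMet}$ is its full subcategory of (Cauchy) complete spaces. Quantitative theories. A signature $\Sigma$ is a set of function symbols $f:n$ of finite arity $n\in\mathbb{N}$. Fix a countably infinite set of variables $V$; terms are $\Sigma$-terms over $V$. A quantitative equation is an expression $t=_\varepsilon s$ with $t,s$ terms and $\varepsilon\in\mathbb{Q}_{\ge0}$. A conditional quantitative equation is $\Gamma\vdash t=_\varepsilon s$ with $\Gamma$ a finite set of quantitative equations. A quantitative equational theory of type $\Sigma$ is a set $\mathcal{U}$ of conditional quantitative equations containing (for all variables and rationals $\varepsilon,\varepsilon'\ge 0$) $\vdash x=_0x$; $\{x=_\varepsilon y\}\vdash y=_\varepsilon x$; $\{x=_\varepsilon z,z=_{\varepsilon'}y\}\vdash x=_{\varepsilon+\varepsilon'}y$; $\{x=_\varepsilon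 y\}\vdash x=_{\varepsilon+\varepsilon'}y$ for $\varepsilon'>0$; $\{x_i=_\varepsilon y_i\mid i=1,\dots,n\}\vdash f(x_1,\dots,x_n)=_\varepsilon f(y_1,\dots,y_n)$ for $f:n\in\Sigma$; and closed under: continuity (if $\Gamma\vdash t=_{\varepsilon'}s\in\mathcal{U}$ for all $\varepsilon'>\varepsilon$ then $\Gamma\vdash t=_\varepsilon s\in\mathcal{U}$), substitution of terms for variables, assumption ($\Gamma\vdash\phi\in\mathcal{U}$ whenever $\phi\in\Gamma$), and cut (if $\Gamma\vdash\phi\in\mathcal{U}$ for all $\phi\in\Theta$ and $\Theta\vdash\psi\in\mathcal{U}$ then $\Gamma\vdash\psi\in\mathcal{U}$). A set $A$ of conditional quantitative equations axiomatizes $\mathcal{U}$ if $\mathcal{U}$ is the smallest theory containing $A$. $\mathcal{U}$ is continuous if it is axiomatized by a collection of continuous schemata, i.e. sets consisting of all $\{x_i=_{\varepsilon_i}y_i\mid i=1,\dots,n\}\vdash t=_\varepsilon s$ with $\varepsilon_i,\varepsilon\in\mathbb{Q}_{\ge0}$ and $\varepsilon\ge f(\varepsilon_1,\dots,\varepsilon_n)$, where $x_i,y_i$ are fixed variables, $t,s$ fixed terms and $f:\mathbb{R}_{\ge0}^n\to\mathbb{R}_{\ge0}$ is a fixed continuous function. Models. A quantitative $\Sigma$-algebra is an extended metric space $A$ with, for each $f:n\in\Sigma$, a map $f^A:A^n\to A$ that is non-expansive for the max metric on $A^n$. It satisfies $\Gamma\vdash t=_\varepsilon s$ if for every assignment $\iota:V\to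 A$ (extended homomorphically to terms), $d_A(\iota(t'),\iota(s'))\le\varepsilon'$ for all $t'=_{\varepsilon'}s'\in\Gamma$ implies $d_A(\iota(t),\iota(s))\le\varepsilon$. $\mathbb{K}(\Sigma,\mathcal{U})$ is the category of quantitative $\Sigma$-algebras satisfying all members of $\mathcal{U}$, with non-expansive $\Sigma$-homomorphisms; $\mathbb{C}\mathbb{K}(\Sigma,\mathcal{U})$ is the full subcategory of those with complete carrier. The forgetful functor $\mathbb{K}(\Sigma,\mathcal{U})\to\mathbf{Met}$ has a left adjoint (known); $T_{\mathcal{U}}$ is the induced monad on $\mathbf{Met}$. For $\mathcal{U}$ continuous, the forgetful functor $\mathbb{C}\mathbb{K}(\Sigma,\mathcal{U})\to\mathbf{CMet}$ has a left adjoint (known), sending $X$ to the Cauchy completion of the free algebra on $X$; the induced monad on $\mathbf{CMet}$ is denoted $\mathbb{C}T_{\mathcal{U}}$. Sum. For $\mathcal{U},\mathcal{U}'$ of types $\Sigma,\Sigma'$ (disjoint), $\mathcal{U}+\mathcal{U}'$ is the smallest quantitative equational theory of type $\Sigma\cup\Sigma'$ containing $\mathcal{U}$ and $\mathcal{U}'$ (it is continuous when both are). A monad map is a natural transformation compatible with units and multiplications. -}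

module Defs where

open import Level using (Level; _⊔_; 0ℓ) renaming (suc to lsuc)
open import Data.Fin.Base as Fin using (Fin; toℕ)
open import Data.Nat.Coprimality using (1-coprimeTo)
open import Data.Nat.Base as ℕ using (ℕ; zero; suc)
import Data.Nat.Properties as ℕₚ
import Data.Integer.Base as ℤ
open import Data.Rational.Base as ℚ using (ℚ; 0ℚ; ½; mkℚ)
import Data.Rational.Properties as ℚₚ
open import Data.Rational.Solver using (module +-*-Solver)
open import Data.List.Base as List using (List; []; _∷_)
import Data.List.Properties as Listₚ
open import Data.List.Membership.Propositional using (_∈_)
open import Data.List.Membership.Propositional.Properties
  using (∈-tabulate⁺; ∈-tabulate⁻; ∈-map⁺; ∈-map⁻)
open import Data.List.Relation.Unary.Any using (here; there)
open import Data.Product using (Σ; ∃; _×_; _,_; proj₁; proj₂)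
open import Data.Sum using (_⊎_; inj₁; inj₂)
open import Data.Vec.Base as Vec using (Vec; []; _∷_)
import Data.Vec.Properties as Vecₚ
open import Function.Base using (_∘_)
open import Relation.Nullary using (¬_; Dec; yes; no; recompute)
open import Relation.Unary using (Pred)
open import Relation.Binary.Bundles using (Setoid)
open import Relation.Binary.Structures using (IsEquivalence)
open import Relation.Binary.PropositionalEquality
  using (_≡_; refl; sym; trans; cong; cong₂; subst; subst₂)
import Relation.Binary.Reasoning.Setoid as SetoidReasoning

record Category (o ℓ e : Level) : Set (lsuc (o ⊔ ℓ ⊔ e)) where
  infix  4 _≈_ _⇒_
  infixr 9 _∙_
  field
    Obj   : Set o
    _⇒_   : Obj → Obj → Set ℓ
    _≈_   : ∀ {A B} → A ⇒ B → A ⇒ B → Set e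
    id    : ∀ {A} → A ⇒ A
    _∙_   : ∀ {A B C} → B ⇒ C → A ⇒ B → A ⇒ C
    equiv : ∀ {A B} → IsEquivalence (_≈_ {A} {B})
    identityˡ : ∀ {A B} {f : A ⇒ B} → id ∙ f ≈ f
    identityʳ : ∀ {A B} {f : A ⇒ B} → f ∙ id ≈ f
    assoc     : ∀ {A B C D} {f : A ⇒ B} {g : B ⇒ C} {h : C ⇒ D} →
                (h ∙ g) ∙ f ≈ h ∙ (g ∙ f)
    ∙-cong    : ∀ {A B C} {f f′ : B ⇒ C} {g g′ : A ⇒ B} →
                f ≈ f′ → g ≈ g′ → f ∙ g ≈ f′ ∙ g′

  hom : Obj → Obj → Setoid ℓ e
  hom A B = record { Carrier = A ⇒ B ; _≈_ = _≈_ ; isEquivalence = equiv }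

  module Eq {A B} = IsEquivalence (equiv {A} {B})
  module HomReasoning {A B} = SetoidReasoning (hom A B)

  ∙-congˡ : ∀ {A B C} {f : B ⇒ C} {g g′ : A ⇒ B} → g ≈ g′ → f ∙ g ≈ f ∙ g′
  ∙-congˡ = ∙-cong Eq.refl

  ∙-congʳ : ∀ {A B C} {f f′ : B ⇒ C} {g : A ⇒ B} → f ≈ f′ → f ∙ g ≈ f′ ∙ g
  ∙-congʳ p = ∙-cong p Eq.refl

  sym-assoc : ∀ {A B C D} {f : A ⇒ B} {g : B ⇒ C} {h : C ⇒ D} →
              h ∙ (g ∙ f) ≈ (h ∙ g) ∙ f
  sym-assoc = Eq.sym assoc

FullSubcategory : ∀ {o ℓ e p} (C : Category o ℓ e) →
                  (Category.Obj C → Set p) → Category (o ⊔ p) ℓ e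
FullSubcategory C P = record
  { Obj = Σ Obj P
  ; _⇒_ = λ A B → proj₁ A ⇒ proj₁ B
  ; _≈_ = _≈_
  ; id = id
  ; _∙_ = _∙_
  ; equiv = equiv
  ; identityˡ = identityˡ
  ; identityʳ = identityʳ
  ; assoc = assoc
  ; ∙-cong = ∙-cong
  }
  where open Category C

record Isomorphic {o ℓ e} (C : Category o ℓ e) (A B : Category.Obj C) : Set (ℓ ⊔ e) where
  open Category C
  field
    to       : A ⇒ B
    from     : B ⇒ A
    to∙from  : to ∙ from ≈ id
    from∙to  : from ∙ to ≈ id

record Coproduct {o ℓ e} (C : Category o ℓ e) (A B : Category.Obj C) : Set (o ⊔ ℓ ⊔ e) where
  open Category C
  field
    obj    : Obj
    i₁     : A ⇒ obj
    i₂     : B ⇒ obj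
    [_,_]  : ∀ {X} → A ⇒ X → B ⇒ X → obj ⇒ X
    inject₁ : ∀ {X} {f : A ⇒ X} {g : B ⇒ X} → [ f , g ] ∙ i₁ ≈ f
    inject₂ : ∀ {X} {f : A ⇒ X} {g : B ⇒ X} → [ f , g ] ∙ i₂ ≈ g
    unique  : ∀ {X} {f : A ⇒ X} {g : B ⇒ X} {h : obj ⇒ X} →
              h ∙ i₁ ≈ f → h ∙ i₂ ≈ g → h ≈ [ f , g ]

record Functor {o ℓ e o′ ℓ′ e′} (C : Category o ℓ e) (D : Category o′ ℓ′ e′) :
               Set (o ⊔ ℓ ⊔ e ⊔ o′ ⊔ ℓ′ ⊔ e′) where
  private
    module C = Category C
    module D = Category D
  field
    F₀     : C.Obj → D.Obj
    F₁     : ∀ {A B} → A C.⇒ B → F₀ A D.⇒ F₀ B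
    F-cong : ∀ {A B} {f g : A C.⇒ B} → f C.≈ g → F₁ f D.≈ F₁ g
    F-id   : ∀ {A} → F₁ (C.id {A}) D.≈ D.id
    F-∙    : ∀ {X Y Z} {f : X C.⇒ Y} {g : Y C.⇒ Z} →
             F₁ (g C.∙ f) D.≈ F₁ g D.∙ F₁ f

idF : ∀ {o ℓ e} {C : Category o ℓ e} → Functor C C
idF {C = C} = record
  { F₀ = λ A → A ; F₁ = λ f → f ; F-cong = λ p → p ; F-id = Eq.refl ; F-∙ = Eq.refl }
  where open Category C

infixr 9 _∘F_
_∘F_ : ∀ {o ℓ e o′ ℓ′ e′ o″ ℓ″ e″}
         {C : Category o ℓ e} {D : Category o′ ℓ′ e′} {E : Category o″ ℓ″ e″} →
       Functor D E → Functor C D → Functor C E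
_∘F_ {E = E} G F = record
  { F₀ = λ A → G.F₀ (F.F₀ A)
  ; F₁ = λ f → G.F₁ (F.F₁ f)
  ; F-cong = λ p → G.F-cong (F.F-cong p)
  ; F-id = Eq.trans (G.F-cong F.F-id) G.F-id
  ; F-∙ = Eq.trans (G.F-cong F.F-∙) G.F-∙
  }
  where
    module G = Functor G
    module F = Functor F
    open Category E

record NaturalTransformation {o ℓ e o′ ℓ′ e′} {C : Category o ℓ e} {D : Category o′ ℓ′ e′}
                             (F G : Functor C D) : Set (o ⊔ ℓ ⊔ e ⊔ o′ ⊔ ℓ′ ⊔ e′) where
  private
    module C = Category C
    module F = Functor F
    module G = Functor G
  open Category D
  field
    at      : ∀ X → F.F₀ X ⇒ G.F₀ X
    natural : ∀ {X Y} (f : X C.⇒ Y) → at Y ∙ F.F₁ f ≈ G.F₁ f ∙ at X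

record Adjunction {o ℓ e o′ ℓ′ e′} {C : Category o ℓ e} {D : Category o′ ℓ′ e′}
                  (L : Functor C D) (R : Functor D C) : Set (o ⊔ ℓ ⊔ e ⊔ o′ ⊔ ℓ′ ⊔ e′) where
  private
    module C = Category C
    module D = Category D
    module L = Functor L
    module R = Functor R
  field
    unit   : NaturalTransformation idF (R ∘F L)
    counit : NaturalTransformation (L ∘F R) idF
  module unit = NaturalTransformation unit
  module counit = NaturalTransformation counit
  field
    zig : ∀ {X} → counit.at (L.F₀ X) D.∙ L.F₁ (unit.at X) D.≈ D.id
    zag : ∀ {Y} → R.F₁ (counit.at Y) C.∙ unit.at (R.F₀ Y) C.≈ C.id

record LeftAdjoint {o ℓ e o′ ℓ′ e′} {C : Category o ℓ e} {D : Category o′ ℓ′ e′}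
                   (R : Functor D C) : Set (o ⊔ ℓ ⊔ e ⊔ o′ ⊔ ℓ′ ⊔ e′) where
  field
    left       : Functor C D
    adjunction : Adjunction left R

module _ {o ℓ e o′ ℓ′ e′} {C : Category o ℓ e} {D : Category o′ ℓ′ e′} (R : Functor D C) where
  private
    module C = Category C
    module D = Category D
    module R = Functor R

  fromUniversalArrows :
    (L₀ : C.Obj → D.Obj)
    (η : ∀ X → X C.⇒ R.F₀ (L₀ X))
    (ext : ∀ {X Y} → X C.⇒ R.F₀ Y → L₀ X D.⇒ Y) →
    (∀ {X Y} (f : X C.⇒ R.F₀ Y) → R.F₁ (ext f) C.∙ η X C.≈ f) →
    (∀ {X Y} {g h : L₀ X D.⇒ Y} → R.F₁ g C.∙ η X C.≈ R.F₁ h C.∙ η X → g D.≈ h) →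
    LeftAdjoint R
  fromUniversalArrows L₀ η ext ext-η jointly-epi = record
    { left = L
    ; adjunction = record
      { unit = record { at = η ; natural = λ f → C.Eq.sym (ext-η (η _ C.∙ f)) }
      ; counit = record { at = λ Y → ext C.id ; natural = ε-natural }
      ; zig = jointly-epi (begin
          R.F₁ (ext C.id D.∙ ext (η _ C.∙ η _)) C.∙ η _            ≈⟨ split ⟩
          R.F₁ (ext C.id) C.∙ R.F₁ (ext (η _ C.∙ η _)) C.∙ η _     ≈⟨ C.∙-congˡ (ext-η _) ⟩
          R.F₁ (ext C.id) C.∙ η _ C.∙ η _                          ≈⟨ C.sym-assoc ⟩
          (R.F₁ (ext C.id) C.∙ η _) C.∙ η _                        ≈⟨ C.∙-congʳ (ext-η _) ⟩
          C.id C.∙ η _                                             ≈⟨ C.∙-congʳ R.F-id ⟨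
          R.F₁ D.id C.∙ η _                                        ∎)
      ; zag = ext-η C.id
      }
    }
    where
      open C.HomReasoning

      split : ∀ {X Y Z} {g : Y D.⇒ Z} {f : L₀ X D.⇒ Y} →
              R.F₁ (g D.∙ f) C.∙ η X C.≈ R.F₁ g C.∙ R.F₁ f C.∙ η X
      split = C.Eq.trans (C.∙-congʳ R.F-∙) C.assoc

      L : Functor C D
      L = record
        { F₀ = L₀
        ; F₁ = λ f → ext (η _ C.∙ f)
        ; F-cong = λ p → jointly-epi
            (C.Eq.trans (ext-η _) (C.Eq.trans (C.∙-congˡ p) (C.Eq.sym (ext-η _))))
        ; F-id = jointly-epi (begin
            R.F₁ (ext (η _ C.∙ C.id)) C.∙ η _  ≈⟨ ext-η _ ⟩
            η _ C.∙ C.id                       ≈⟨ C.identityʳ ⟩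
            η _                                ≈⟨ C.identityˡ ⟨
            C.id C.∙ η _                       ≈⟨ C.∙-congʳ R.F-id ⟨
            R.F₁ D.id C.∙ η _                  ∎)
        ; F-∙ = λ {X} {Y} {Z} {f} {g} → jointly-epi (begin
            R.F₁ (ext (η _ C.∙ g C.∙ f)) C.∙ η _                           ≈⟨ ext-η _ ⟩
            η _ C.∙ g C.∙ f                                                ≈⟨ C.sym-assoc ⟩
            (η _ C.∙ g) C.∙ f                                              ≈⟨ C.∙-congʳ (ext-η _) ⟨
            (R.F₁ (ext (η _ C.∙ g)) C.∙ η _) C.∙ f                         ≈⟨ C.assoc ⟩
            R.F₁ (ext (η _ C.∙ g)) C.∙ η _ C.∙ f                           ≈⟨ C.∙-congˡ (ext-η _) ⟨
            R.F₁ (ext (η _ C.∙ g)) C.∙ R.F₁ (ext (η _ C.∙ f)) C.∙ η _      ≈⟨ split ⟨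
            R.F₁ (ext (η _ C.∙ g) D.∙ ext (η _ C.∙ f)) C.∙ η _             ∎)
        }

      ε-natural : ∀ {X Y} (f : X D.⇒ Y) →
                  ext C.id D.∙ ext (η _ C.∙ R.F₁ f) D.≈ f D.∙ ext C.id
      ε-natural f = jointly-epi (begin
        R.F₁ (ext C.id D.∙ ext (η _ C.∙ R.F₁ f)) C.∙ η _          ≈⟨ split ⟩
        R.F₁ (ext C.id) C.∙ R.F₁ (ext (η _ C.∙ R.F₁ f)) C.∙ η _   ≈⟨ C.∙-congˡ (ext-η _) ⟩
        R.F₁ (ext C.id) C.∙ η _ C.∙ R.F₁ f                        ≈⟨ C.sym-assoc ⟩
        (R.F₁ (ext C.id) C.∙ η _) C.∙ R.F₁ f                      ≈⟨ C.∙-congʳ (ext-η _) ⟩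
        C.id C.∙ R.F₁ f                                           ≈⟨ C.identityˡ ⟩
        R.F₁ f                                                    ≈⟨ C.identityʳ ⟨
        R.F₁ f C.∙ C.id                                           ≈⟨ C.∙-congˡ (ext-η _) ⟨
        R.F₁ f C.∙ R.F₁ (ext C.id) C.∙ η _                        ≈⟨ split ⟨
        R.F₁ (f D.∙ ext C.id) C.∙ η _                             ∎)

record Monad {o ℓ e} (C : Category o ℓ e) : Set (o ⊔ ℓ ⊔ e) where
  open Category C
  field
    functor : Functor C C
    unit    : NaturalTransformation idF functor
    mult    : NaturalTransformation (functor ∘F functor) functor
  open Functor functor public renaming (F₀ to T₀; F₁ to T₁; F-cong to T-cong; F-id to T-id; F-∙ to T-∙)
  module η = NaturalTransformation unit
  module μ = NaturalTransformation mult
  field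
    μ-assoc : ∀ {X} → μ.at X ∙ T₁ (μ.at X) ≈ μ.at X ∙ μ.at (T₀ X)
    μ-Tη    : ∀ {X} → μ.at X ∙ T₁ (η.at X) ≈ id
    μ-ηT    : ∀ {X} → μ.at X ∙ η.at (T₀ X) ≈ id

inducedMonad : ∀ {o ℓ e o′ ℓ′ e′} {C : Category o ℓ e} {D : Category o′ ℓ′ e′}
               {R : Functor D C} → LeftAdjoint R → Monad C
inducedMonad {C = C} {D = D} {R = R} leftAdjoint = record
  { functor = R ∘F left
  ; unit = unit
  ; mult = record
    { at = λ X → R.F₁ (counit.at (L.F₀ X))
    ; natural = λ f → image (counit.natural (L.F₁ f))
    }
  ; μ-assoc = C.Eq.sym (image (D.Eq.sym (counit.natural (counit.at _))))
  ; μ-Tη = C.Eq.trans (C.Eq.sym R.F-∙) (C.Eq.trans (R.F-cong zig) R.F-id)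
  ; μ-ηT = zag
  }
  where
    open LeftAdjoint leftAdjoint
    open Adjunction adjunction
    module C = Category C
    module D = Category D
    module L = Functor left
    module R = Functor R
    image : ∀ {X Y Y′ Z} {f : X D.⇒ Y} {g : Y D.⇒ Z} {f′ : X D.⇒ Y′} {g′ : Y′ D.⇒ Z} →
            g D.∙ f D.≈ g′ D.∙ f′ → R.F₁ g C.∙ R.F₁ f C.≈ R.F₁ g′ C.∙ R.F₁ f′
    image p = C.Eq.trans (C.Eq.sym R.F-∙) (C.Eq.trans (R.F-cong p) R.F-∙)

record MonadMap {o ℓ e} {C : Category o ℓ e} (S T : Monad C) : Set (o ⊔ ℓ ⊔ e) where
  private
    module S = Monad S
    module T = Monad T
  open Category C
  field
    transformation : NaturalTransformation S.functor T.functor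
  open NaturalTransformation transformation public
  field
    resp-unit : ∀ {X} → at X ∙ S.η.at X ≈ T.η.at X
    resp-mult : ∀ {X} → at X ∙ S.μ.at X ≈ T.μ.at X ∙ T.T₁ (at X) ∙ at (S.T₀ X)

Monads : ∀ {o ℓ e} → Category o ℓ e → Category (o ⊔ ℓ ⊔ e) (o ⊔ ℓ ⊔ e) (o ⊔ e)
Monads C = record
  { Obj = Monad C
  ; _⇒_ = MonadMap
  ; _≈_ = λ σ τ → ∀ X → MonadMap.at σ X ≈ MonadMap.at τ X
  ; id = idM
  ; _∙_ = _∘M_
  ; equiv = record
    { refl = λ X → Eq.refl ; sym = λ p X → Eq.sym (p X) ; trans = λ p q X → Eq.trans (p X) (q X) }
  ; identityˡ = λ X → identityˡ
  ; identityʳ = λ X → identityʳ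
  ; assoc = λ X → assoc
  ; ∙-cong = λ p q X → ∙-cong (p X) (q X)
  }
  where
    open Category C
    open HomReasoning

    idM : ∀ {T : Monad C} → MonadMap T T
    idM {T} = record
      { transformation = record
        { at = λ X → id ; natural = λ f → Eq.trans identityˡ (Eq.sym identityʳ) }
      ; resp-unit = identityˡ
      ; resp-mult = λ {X} → begin
          id ∙ T.μ.at X             ≈⟨ identityˡ ⟩
          T.μ.at X                  ≈⟨ identityʳ ⟨
          T.μ.at X ∙ id             ≈⟨ ∙-congˡ T.T-id ⟨
          T.μ.at X ∙ T.T₁ id        ≈⟨ ∙-congˡ identityʳ ⟨
          T.μ.at X ∙ T.T₁ id ∙ id   ∎
      }
      where module T = Monad T

    _∘M_ : ∀ {S T V : Monad C} → MonadMap T V → MonadMap S T → MonadMap S V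
    _∘M_ {S} {T} {V} σ τ = record
      { transformation = record
        { at = λ X → σ.at X ∙ τ.at X
        ; natural = λ {X} {Y} f → begin
            (σ.at Y ∙ τ.at Y) ∙ S.T₁ f   ≈⟨ assoc ⟩
            σ.at Y ∙ τ.at Y ∙ S.T₁ f     ≈⟨ ∙-congˡ (τ.natural f) ⟩
            σ.at Y ∙ T.T₁ f ∙ τ.at X     ≈⟨ sym-assoc ⟩
            (σ.at Y ∙ T.T₁ f) ∙ τ.at X   ≈⟨ ∙-congʳ (σ.natural f) ⟩
            (V.T₁ f ∙ σ.at X) ∙ τ.at X   ≈⟨ assoc ⟩
            V.T₁ f ∙ σ.at X ∙ τ.at X     ∎
        }
      ; resp-unit = λ {X} → begin
          (σ.at X ∙ τ.at X) ∙ S.η.at X   ≈⟨ assoc ⟩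
          σ.at X ∙ τ.at X ∙ S.η.at X     ≈⟨ ∙-congˡ τ.resp-unit ⟩
          σ.at X ∙ T.η.at X              ≈⟨ σ.resp-unit ⟩
          V.η.at X                       ∎
      ; resp-mult = λ {X} → begin
          (σ.at X ∙ τ.at X) ∙ S.μ.at X
            ≈⟨ assoc ⟩
          σ.at X ∙ τ.at X ∙ S.μ.at X
            ≈⟨ ∙-congˡ τ.resp-mult ⟩
          σ.at X ∙ T.μ.at X ∙ T.T₁ (τ.at X) ∙ τ.at (S.T₀ X)
            ≈⟨ sym-assoc ⟩
          (σ.at X ∙ T.μ.at X) ∙ T.T₁ (τ.at X) ∙ τ.at (S.T₀ X)
            ≈⟨ ∙-congʳ σ.resp-mult ⟩
          (V.μ.at X ∙ V.T₁ (σ.at X) ∙ σ.at (T.T₀ X)) ∙ T.T₁ (τ.at X) ∙ τ.at (S.T₀ X)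
            ≈⟨ assoc ⟩
          V.μ.at X ∙ (V.T₁ (σ.at X) ∙ σ.at (T.T₀ X)) ∙ T.T₁ (τ.at X) ∙ τ.at (S.T₀ X)
            ≈⟨ ∙-congˡ assoc ⟩
          V.μ.at X ∙ V.T₁ (σ.at X) ∙ σ.at (T.T₀ X) ∙ T.T₁ (τ.at X) ∙ τ.at (S.T₀ X)
            ≈⟨ ∙-congˡ (∙-congˡ sym-assoc) ⟩
          V.μ.at X ∙ V.T₁ (σ.at X) ∙ (σ.at (T.T₀ X) ∙ T.T₁ (τ.at X)) ∙ τ.at (S.T₀ X)
            ≈⟨ ∙-congˡ (∙-congˡ (∙-congʳ (σ.natural (τ.at X)))) ⟩
          V.μ.at X ∙ V.T₁ (σ.at X) ∙ (V.T₁ (τ.at X) ∙ σ.at (S.T₀ X)) ∙ τ.at (S.T₀ X)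
            ≈⟨ ∙-congˡ (∙-congˡ assoc) ⟩
          V.μ.at X ∙ V.T₁ (σ.at X) ∙ V.T₁ (τ.at X) ∙ σ.at (S.T₀ X) ∙ τ.at (S.T₀ X)
            ≈⟨ ∙-congˡ sym-assoc ⟩
          V.μ.at X ∙ (V.T₁ (σ.at X) ∙ V.T₁ (τ.at X)) ∙ σ.at (S.T₀ X) ∙ τ.at (S.T₀ X)
            ≈⟨ ∙-congˡ (∙-congʳ V.T-∙) ⟨
          V.μ.at X ∙ V.T₁ (σ.at X ∙ τ.at X) ∙ σ.at (S.T₀ X) ∙ τ.at (S.T₀ X)
            ∎
      }
      where
        module S = Monad S
        module T = Monad T
        module V = Monad V
        module σ = MonadMap σ
        module τ = MonadMap τ

record ℚ≥0 : Set where
  constructor mk≥0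
  field
    value   : ℚ
    .nonNeg : 0ℚ ℚ.≤ value
open ℚ≥0 public using (value)

infix 4 _≤_ _<_
_≤_ _<_ : ℚ≥0 → ℚ≥0 → Set
p ≤ q = value p ℚ.≤ value q
p < q = value p ℚ.< value q

infixl 6 _+_
_+_ : ℚ≥0 → ℚ≥0 → ℚ≥0
mk≥0 p 0≤p + mk≥0 q 0≤q = mk≥0 (p ℚ.+ q) (ℚₚ.+-mono-≤ 0≤p 0≤q)

0≥0 : ℚ≥0
0≥0 = mk≥0 0ℚ ℚₚ.≤-refl

record ℚ⁺ : Set where
  constructor mk⁺
  field
    rat       : ℚ≥0
    .positive : 0≥0 < rat
open ℚ⁺ public using (rat)

value-injective : ∀ {p q} → value p ≡ value q → p ≡ q
value-injective refl = refl

opaque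
  0≤ : ∀ p → 0≥0 ≤ p
  0≤ (mk≥0 p 0≤p) = recompute (0ℚ ℚₚ.≤? p) 0≤p

  0<⁺ : ∀ δ → 0≥0 < rat δ
  0<⁺ (mk⁺ p 0<p) = recompute (0ℚ ℚₚ.<? value p) 0<p

p<p+δ : ∀ p δ → p < p + rat δ
p<p+δ p δ = subst (ℚ._< value (p + rat δ)) (ℚₚ.+-identityʳ (value p))
                  (ℚₚ.+-monoʳ-< (value p) (0<⁺ δ))

p≤p+q : ∀ p q → p ≤ p + q
p≤p+q p q = subst (ℚ._≤ value (p + q)) (ℚₚ.+-identityʳ (value p))
                  (ℚₚ.+-monoʳ-≤ (value p) (0≤ q))

+-mono : ∀ {p p′ q q′} → p ≤ p′ → q ≤ q′ → p + q ≤ p′ + q′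
+-mono = ℚₚ.+-mono-≤

+-comm : ∀ p q → p + q ≡ q + p
+-comm p q = value-injective (ℚₚ.+-comm (value p) (value q))

+-assoc : ∀ p q r → p + q + r ≡ p + (q + r)
+-assoc p q r = value-injective (ℚₚ.+-assoc (value p) (value q) (value r))

+-identityˡ : ∀ p → 0≥0 + p ≡ p
+-identityˡ p = value-injective (ℚₚ.+-identityˡ (value p))

≤-reflexive : ∀ {p q} → p ≡ q → p ≤ q
≤-reflexive p≡q = ℚₚ.≤-reflexive (cong value p≡q)

gap : ∀ {p q} → p < q → Σ ℚ⁺ λ δ → p + rat δ ≡ q
gap {p} {q} p<q = mk⁺ (mk≥0 (value q ℚ.- value p) (ℚₚ.<⇒≤ 0<q-p)) 0<q-p
                , value-injective (solve 2 (λ p q → p :+ (q :- p) := q) refl (value p) (value q))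
  where
    open +-*-Solver
    0<q-p : 0ℚ ℚ.< value q ℚ.- value p
    0<q-p = subst (ℚ._< value q ℚ.- value p) (ℚₚ.+-inverseʳ (value p))
                  (ℚₚ.+-monoˡ-< (ℚ.- value p) p<q)

half : ℚ⁺ → ℚ⁺
half δ = mk⁺ (mk≥0 (½ ℚ.* value (rat δ)) (ℚₚ.<⇒≤ 0<½δ)) 0<½δ
  where
    0<½δ : 0ℚ ℚ.< ½ ℚ.* value (rat δ)
    0<½δ = subst (ℚ._< ½ ℚ.* value (rat δ)) (ℚₚ.*-zeroʳ ½) (ℚₚ.*-monoʳ-<-pos ½ (0<⁺ δ))

half+half : ∀ δ → rat (half δ) + rat (half δ) ≡ rat δ
half+half δ = value-injective
  (trans (sym (ℚₚ.*-distribʳ-+ (value (rat δ)) ½ ½)) (ℚₚ.*-identityˡ (value (rat δ))))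

-- An element r of [0,∞] is given by its upper cut { ε ∈ ℚ≥0 | r ≤ ε }.
-- Such cuts are the sets of rationals that are upward closed and closed under
-- infima; the empty one is ∞.
record [0,∞] : Set₁ where
  infix 4 _≼_
  field
    _≼_    : ℚ≥0 → Set
    upward : ∀ {p q} → p ≤ q → _≼_ p → _≼_ q
    closed : ∀ {p} → (∀ q → p < q → _≼_ q) → _≼_ p
open [0,∞] public

infix 4 _≤∞_ _≈∞_
_≤∞_ _≈∞_ : [0,∞] → [0,∞] → Set
r ≤∞ s = ∀ {q} → s ≼ q → r ≼ q
r ≈∞ s = r ≤∞ s × s ≤∞ r

↑_ : ℚ≥0 → [0,∞]
↑ p = record
  { _≼_ = p ≤_
  ; upward = λ q≤q′ p≤q → ℚₚ.≤-trans p≤q q≤q′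
  ; closed = λ {q} p≤ → ℚₚ.≮⇒≥ λ q<p →
      let (γ , q+γ≡p) = gap {q} {p} q<p
          q+½γ<p : q + rat (half γ) < p
          q+½γ<p = subst (q + rat (half γ) <_)
                     (trans (+-assoc q (rat (half γ)) (rat (half γ)))
                            (trans (cong (q +_) (half+half γ)) q+γ≡p))
                     (p<p+δ (q + rat (half γ)) (half γ))
      in ℚₚ.<-irrefl refl (ℚₚ.<-≤-trans q+½γ<p (p≤ (q + rat (half γ)) (p<p+δ q (half γ))))
  }

-- r + s = inf { a + b | r ≤ a, s ≤ b }.
infixl 6 _⊕_
_⊕_ : [0,∞] → [0,∞] → [0,∞]
r ⊕ s = record
  { _≼_ = λ p → ∀ q → p < q → ∃ λ a → ∃ λ b → r ≼ a × s ≼ b × a + b ≤ q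
  ; upward = λ p≤p′ h q p′<q → h q (ℚₚ.≤-<-trans p≤p′ p′<q)
  ; closed = λ {p} h q p<q →
      let (γ , p+γ≡q) = gap {p} {q} p<q
          m = p + rat (half γ)
          m<q : m < q
          m<q = subst (m <_)
                  (trans (+-assoc p (rat (half γ)) (rat (half γ)))
                         (trans (cong (p +_) (half+half γ)) p+γ≡q))
                  (p<p+δ m (half γ))
      in h m (p<p+δ p (half γ)) q m<q
  }

-- The maximum of finitely many distances; 0 when n = 0.
⋁ : ∀ {n} → (Fin n → [0,∞]) → [0,∞]
⋁ r = record
  { _≼_ = λ q → ∀ i → r i ≼ q
  ; upward = λ p≤q h i → upward (r i) p≤q (h i)
  ; closed = λ h i → closed (r i) λ q p<q → h q p<q i
  }

closed⁺ : ∀ r {p} → (∀ γ → r ≼ p + rat γ) → r ≼ p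
closed⁺ r {p} h = closed r λ q p<q →
  let (γ , p+γ≡q) = gap {p} {q} p<q in subst (r ≼_) p+γ≡q (h γ)

closed₂ : ∀ r {p} → (∀ γ → r ≼ p + (rat γ + rat γ)) → r ≼ p
closed₂ r {p} h = closed⁺ r λ γ → subst (λ x → r ≼ p + x) (half+half γ) (h (half γ))

closed₄ : ∀ r {p} → (∀ γ → r ≼ p + ((rat γ + rat γ) + (rat γ + rat γ))) → r ≼ p
closed₄ r {p} h = closed₂ r λ γ →
  subst (λ x → r ≼ p + (x + x)) (half+half γ) (h (half γ))

-- Non-negative reals: the finite, located elements of [0,∞].  Locatedness
-- holds for every element in classical logic; constructively it makes these
-- the (Dedekind) reals, so that f in a schema below need not be monotone.
record ℝ≥0 : Set₁ where
  field
    real    : [0,∞]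
    finite  : ∃ λ q → real ≼ q
    located : ∀ p q → p < q → ¬ (real ≼ p) ⊎ real ≼ q
open ℝ≥0 public using (real)

↑ℝ_ : ℚ≥0 → ℝ≥0
↑ℝ r = record
  { real = ↑ r
  ; finite = r , ℚₚ.≤-refl
  ; located = λ p q p<q → located p q p<q (value r ℚₚ.≤? value p)
  }
  where
    located : ∀ p q → p < q → Dec (r ≤ p) → ¬ (r ≤ p) ⊎ r ≤ q
    located p q p<q (yes r≤p) = inj₂ (ℚₚ.≤-trans r≤p (ℚₚ.<⇒≤ p<q))
    located p q p<q (no r≰p) = inj₁ r≰p

∣_-_∣≤_ : ℝ≥0 → ℝ≥0 → ℚ≥0 → Set
∣ x - y ∣≤ ε = real x ≤∞ real y ⊕ ↑ ε × real y ≤∞ real x ⊕ ↑ ε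

Continuousᶠ : ∀ {n} → ((Fin n → ℝ≥0) → ℝ≥0) → Set₁
Continuousᶠ {n} f = ∀ x (ε : ℚ⁺) → Σ ℚ⁺ λ δ →
  ∀ y → (∀ i → ∣ x i - y i ∣≤ rat δ) → ∣ f x - f y ∣≤ rat ε

record Metric : Set₁ where
  no-eta-equality
  infix 4 _≈_
  field
    Carrier       : Set
    _≈_           : Carrier → Carrier → Set
    isEquivalence : IsEquivalence _≈_
    dist          : Carrier → Carrier → [0,∞]
    dist≈0⇒≈      : ∀ {x y} → dist x y ≈∞ ↑ 0≥0 → x ≈ y
    ≈⇒dist≈0      : ∀ {x y} → x ≈ y → dist x y ≈∞ ↑ 0≥0
    symmetry      : ∀ x y → dist x y ≈∞ dist y x
    triangle      : ∀ x y z → dist x z ≤∞ dist x y ⊕ dist y z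

  open IsEquivalence isEquivalence public
    renaming (refl to ≈-refl; sym to ≈-sym; trans to ≈-trans)

  ≼-sym : ∀ {x y p} → dist x y ≼ p → dist y x ≼ p
  ≼-sym {x} {y} = proj₁ (symmetry y x)

  ≼-trans : ∀ {x y z p q} → dist x y ≼ p → dist y z ≼ q → dist x z ≼ p + q
  ≼-trans {x} {y} {z} {p} {q} xy yz =
    triangle x y z λ r p+q<r → p , q , xy , yz , ℚₚ.<⇒≤ p+q<r

  ≼0⇒≈ : ∀ {x y} → dist x y ≼ 0≥0 → x ≈ y
  ≼0⇒≈ xy = dist≈0⇒≈ ((λ 0≤q → upward (dist _ _) 0≤q xy) , λ {q} _ → 0≤ q)

  ≈⇒≼ : ∀ {x y p} → x ≈ y → dist x y ≼ p
  ≈⇒≼ {p = p} x≈y = proj₁ (≈⇒dist≈0 x≈y) (0≤ p)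

  ≼-upto : ∀ {x y p q} → p ≤ q → dist x y ≼ p → dist x y ≼ q
  ≼-upto = upward (dist _ _)

  ≼-respˡ : ∀ {x x′ y p} → x ≈ x′ → dist x′ y ≼ p → dist x y ≼ p
  ≼-respˡ {p = p} x≈x′ x′y =
    ≼-upto (≤-reflexive (+-identityˡ p)) (≼-trans (≈⇒≼ {p = 0≥0} x≈x′) x′y)

  ≼-respʳ : ∀ {x y y′ p} → y′ ≈ y → dist x y′ ≼ p → dist x y ≼ p
  ≼-respʳ y′≈y xy′ = ≼-sym (≼-respˡ (≈-sym y′≈y) (≼-sym xy′))

-- The space of distances inf { p | R x p y }, points at distance 0 being identified.
module _ {X : Set} (R : X → ℚ≥0 → X → Set)
         (R-up : ∀ {x y p q} → p ≤ q → R x p y → R x q y)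
         (R-closed : ∀ {x y p} → (∀ q → p < q → R x q y) → R x p y)
         (R-refl : ∀ {x} → R x 0≥0 x)
         (R-sym : ∀ {x y p} → R x p y → R y p x)
         (R-trans : ∀ {x y z p q} → R x p y → R y q z → R x (p + q) z) where
  private
    d : X → X → [0,∞]
    d x y = record { _≼_ = λ p → R x p y ; upward = R-up ; closed = R-closed }

  metricFromRelation : Metric
  metricFromRelation = record
    { Carrier = X
    ; _≈_ = λ x y → d x y ≈∞ ↑ 0≥0
    ; isEquivalence = record
      { refl = is0 R-refl
      ; sym = λ p → is0 (R-sym (at0 p))
      ; trans = λ p q → is0 (R-up (≤-reflexive (+-identityˡ 0≥0)) (R-trans (at0 p) (at0 q)))
      }
    ; dist = d
    ; dist≈0⇒≈ = λ p → p
    ; ≈⇒dist≈0 = λ p → p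
    ; symmetry = λ x y → R-sym , R-sym
    ; triangle = λ x y z {p} h → R-closed λ q p<q →
        let (a , b , xy , yz , a+b≤q) = h q p<q in R-up a+b≤q (R-trans xy yz)
    }
    where
      is0 : ∀ {x y} → R x 0≥0 y → d x y ≈∞ ↑ 0≥0
      is0 Rxy = (λ 0≤q → R-up 0≤q Rxy) , λ {q} _ → 0≤ q
      at0 : ∀ {x y} → d x y ≈∞ ↑ 0≥0 → R x 0≥0 y
      at0 p = proj₁ p (0≤ 0≥0)

record NonExpansive (X Y : Metric) : Set where
  private
    module X = Metric X
    module Y = Metric Y
  field
    fun    : X.Carrier → Y.Carrier
    nonexp : ∀ x x′ → Y.dist (fun x) (fun x′) ≤∞ X.dist x x′

  resp : ∀ {x x′} → x X.≈ x′ → fun x Y.≈ fun x′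
  resp x≈x′ = Y.≼0⇒≈ (nonexp _ _ (X.≈⇒≼ x≈x′))
open NonExpansive public

Met : Category (lsuc 0ℓ) 0ℓ 0ℓ
Met = record
  { Obj = Metric
  ; _⇒_ = NonExpansive
  ; _≈_ = λ {X} {Y} f g → ∀ x → Metric._≈_ Y (fun f x) (fun g x)
  ; id = record { fun = λ x → x ; nonexp = λ x x′ p → p }
  ; _∙_ = λ g f → record
    { fun = λ x → fun g (fun f x) ; nonexp = λ x x′ p → nonexp g _ _ (nonexp f x x′ p) }
  ; equiv = λ {X} {Y} → record
    { refl = λ x → Metric.≈-refl Y
    ; sym = λ p x → Metric.≈-sym Y (p x)
    ; trans = λ p q x → Metric.≈-trans Y (p x) (q x)
    }
  ; identityˡ = λ {X} {Y} x → Metric.≈-refl Y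
  ; identityʳ = λ {X} {Y} x → Metric.≈-refl Y
  ; assoc = λ {A} {B} {C} {D} x → Metric.≈-refl D
  ; ∙-cong = λ {A} {B} {C} {f} {f′} p q x → Metric.≈-trans C (resp f (q x)) (p _)
  }

module _ (X : Metric) where
  open Metric X

  IsCauchy : (ℕ → Carrier) → Set
  IsCauchy s = ∀ (ε : ℚ⁺) → ∃ λ N → ∀ m n → N ℕ.≤ m → N ℕ.≤ n → dist (s m) (s n) ≼ rat ε

  _ConvergesTo_ : (ℕ → Carrier) → Carrier → Set
  s ConvergesTo x = ∀ (ε : ℚ⁺) → ∃ λ N → ∀ n → N ℕ.≤ n → dist (s n) x ≼ rat ε

  Complete : Set
  Complete = ∀ s → IsCauchy s → ∃ λ x → s ConvergesTo x

CMet : Category (lsuc 0ℓ) 0ℓ 0ℓ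
CMet = FullSubcategory Met Complete

Power : Metric → ℕ → Metric
Power X n = record
  { Carrier = Vec Carrier n
  ; _≈_ = λ xs ys → ∀ i → Vec.lookup xs i ≈ Vec.lookup ys i
  ; isEquivalence = record
    { refl = λ i → ≈-refl ; sym = λ p i → ≈-sym (p i) ; trans = λ p q i → ≈-trans (p i) (q i) }
  ; dist = λ xs ys → ⋁ λ i → dist (Vec.lookup xs i) (Vec.lookup ys i)
  ; dist≈0⇒≈ = λ p i → ≼0⇒≈ (proj₁ p (0≤ 0≥0) i)
  ; ≈⇒dist≈0 = λ p → (λ 0≤q i → ≈⇒≼ (p i)) , λ {q} _ → 0≤ q
  ; symmetry = λ xs ys → (λ p i → ≼-sym (p i)) , λ p i → ≼-sym (p i)
  ; triangle = λ xs ys zs h i → triangle _ _ _ λ q p<q →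
      let (a , b , xy , yz , a+b≤q) = h q p<q in a , b , xy i , yz i , a+b≤q
  }
  where open Metric X

record Signature : Set₁ where
  field
    Op : Set
    ar : Op → ℕ
open Signature public

data Term (S : Signature) (X : Set) : Set where
  var  : X → Term S X
  node : (f : Op S) → Vec (Term S X) (ar S f) → Term S X

module _ {S : Signature} {X B : Set} (alg : ∀ f → Vec B (ar S f) → B) (ι : X → B) where
  fold  : Term S X → B
  folds : ∀ {n} → Vec (Term S X) n → Vec B n
  fold (var x)     = ι x
  fold (node f ts) = alg f (folds ts)
  folds []       = []
  folds (t ∷ ts) = fold t ∷ folds ts

  folds-map : ∀ {n} (ts : Vec (Term S X) n) → folds ts ≡ Vec.map fold ts
  folds-map []       = refl
  folds-map (t ∷ ts) = cong (fold t ∷_) (folds-map ts)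

  folds-tabulate : ∀ {n} (x : Fin n → X) → folds (Vec.tabulate (var ∘ x)) ≡ Vec.tabulate (ι ∘ x)
  folds-tabulate {zero}  x = refl
  folds-tabulate {suc n} x = cong (ι (x Fin.zero) ∷_) (folds-tabulate (x ∘ Fin.suc))

_[_] : ∀ {S X Y} → Term S X → (X → Term S Y) → Term S Y
t [ σ ] = fold node σ t

module _ {S : Signature} {X Y B : Set} {alg : ∀ f → Vec B (ar S f) → B}
         (σ : X → Term S Y) (ι : Y → B) where
  fold-[]  : ∀ t → fold alg ι (t [ σ ]) ≡ fold alg (fold alg ι ∘ σ) t
  folds-[] : ∀ {n} (ts : Vec (Term S X) n) →
             folds alg ι (folds node σ ts) ≡ folds alg (fold alg ι ∘ σ) ts
  fold-[] (var x)     = refl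
  fold-[] (node f ts) = cong (alg f) (folds-[] ts)
  folds-[] []       = refl
  folds-[] (t ∷ ts) = cong₂ _∷_ (fold-[] t) (folds-[] ts)

V : Set
V = ℕ

infix 6 _≐[_]_
record Equation (S : Signature) : Set where
  constructor _≐[_]_
  field
    lhs   : Term S V
    bound : ℚ≥0
    rhs   : Term S V
open Equation public

-- The finite set of hypotheses is listed; only membership in it matters.
infix 3 _⊢_
record Conditional (S : Signature) : Set where
  constructor _⊢_
  field
    hypotheses : List (Equation S)
    conclusion : Equation S

mapEq : ∀ {S S′} → (Term S V → Term S′ V) → Equation S → Equation S′
mapEq h (t ≐[ ε ] s) = h t ≐[ ε ] h s

mapCond : ∀ {S S′} → (Term S V → Term S′ V) → Conditional S → Conditional S′
mapCond h (Γ ⊢ φ) = List.map (mapEq h) Γ ⊢ mapEq h φ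

-- { xᵢ =_{εᵢ} yᵢ | i < n }
varEqs : ∀ {S n} → (x y : Fin n → V) → (Fin n → ℚ≥0) → List (Equation S)
varEqs x y ε = List.tabulate λ i → var (x i) ≐[ ε i ] var (y i)

record IsTheory {S : Signature} (U : Pred (Conditional S) 0ℓ) : Set where
  field
    reflexivity  : ∀ x → U ([] ⊢ var x ≐[ 0≥0 ] var x)
    symmetry     : ∀ x y ε → U (var x ≐[ ε ] var y ∷ [] ⊢ var y ≐[ ε ] var x)
    triangle     : ∀ x y z ε ε′ →
                   U (var x ≐[ ε ] var z ∷ var z ≐[ ε′ ] var y ∷ [] ⊢ var x ≐[ ε + ε′ ] var y)
    weakening    : ∀ x y ε ε′ → 0≥0 < ε′ → U (var x ≐[ ε ] var y ∷ [] ⊢ var x ≐[ ε + ε′ ] var y)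
    nonexpansive : ∀ f (x y : Fin (ar S f) → V) ε →
                   U (varEqs x y (λ _ → ε) ⊢
                      node f (Vec.tabulate (var ∘ x)) ≐[ ε ] node f (Vec.tabulate (var ∘ y)))
    continuity   : ∀ Γ t s ε → (∀ ε′ → ε < ε′ → U (Γ ⊢ t ≐[ ε′ ] s)) → U (Γ ⊢ t ≐[ ε ] s)
    substitution : ∀ (σ : V → Term S V) φ → U φ → U (mapCond (_[ σ ]) φ)
    assumption   : ∀ Γ φ → φ ∈ Γ → U (Γ ⊢ φ)
    cut          : ∀ Γ Θ ψ → (∀ φ → φ ∈ Θ → U (Γ ⊢ φ)) → U (Θ ⊢ ψ) → U (Γ ⊢ ψ)

record Theory (S : Signature) : Set₁ where
  field
    Holds    : Pred (Conditional S) 0ℓ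
    isTheory : IsTheory Holds
  open IsTheory isTheory public
open Theory public using (Holds; isTheory)

record Axiomatizes {S : Signature} (A : Pred (Conditional S) 0ℓ) (U : Theory S) : Set₁ where
  field
    contains : ∀ φ → A φ → Holds U φ
    least    : ∀ (W : Theory S) → (∀ φ → A φ → Holds W φ) → ∀ φ → Holds U φ → Holds W φ

data Derivable {S : Signature} (A : Pred (Conditional S) 0ℓ) : Pred (Conditional S) 0ℓ where
  axiom        : ∀ φ → A φ → Derivable A φ
  reflexivity  : ∀ x → Derivable A ([] ⊢ var x ≐[ 0≥0 ] var x)
  symmetry     : ∀ x y ε → Derivable A (var x ≐[ ε ] var y ∷ [] ⊢ var y ≐[ ε ] var x)
  triangle     : ∀ x y z ε ε′ → Derivable A
                 (var x ≐[ ε ] var z ∷ var z ≐[ ε′ ] var y ∷ [] ⊢ var x ≐[ ε + ε′ ] var y)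
  weakening    : ∀ x y ε ε′ → 0≥0 < ε′ →
                 Derivable A (var x ≐[ ε ] var y ∷ [] ⊢ var x ≐[ ε + ε′ ] var y)
  nonexpansive : ∀ f (x y : Fin (ar S f) → V) ε → Derivable A
                 (varEqs x y (λ _ → ε) ⊢
                  node f (Vec.tabulate (var ∘ x)) ≐[ ε ] node f (Vec.tabulate (var ∘ y)))
  continuity   : ∀ Γ t s ε → (∀ ε′ → ε < ε′ → Derivable A (Γ ⊢ t ≐[ ε′ ] s)) →
                 Derivable A (Γ ⊢ t ≐[ ε ] s)
  substitution : ∀ (σ : V → Term S V) φ → Derivable A φ → Derivable A (mapCond (_[ σ ]) φ)
  assumption   : ∀ Γ φ → φ ∈ Γ → Derivable A (Γ ⊢ φ)
  cut          : ∀ Γ Θ ψ → (∀ φ → φ ∈ Θ → Derivable A (Γ ⊢ φ)) → Derivable A (Θ ⊢ ψ) →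
                 Derivable A (Γ ⊢ ψ)

generated : ∀ {S} → Pred (Conditional S) 0ℓ → Theory S
generated A = record
  { Holds = Derivable A
  ; isTheory = record
    { reflexivity = reflexivity ; symmetry = symmetry ; triangle = triangle
    ; weakening = weakening ; nonexpansive = nonexpansive ; continuity = continuity
    ; substitution = substitution ; assumption = assumption ; cut = cut
    }
  }

generated-axiomatized : ∀ {S} (A : Pred (Conditional S) 0ℓ) → Axiomatizes A (generated A)
generated-axiomatized A = record { contains = axiom ; least = least }
  where
    least : ∀ W → (∀ φ → A φ → Holds W φ) → ∀ φ → Derivable A φ → Holds W φ
    least W A⊆W = go
      where
        module W = Theory W
        go : ∀ φ → Derivable A φ → Holds W φ
        go _ (axiom φ p)              = A⊆W φ p
        go _ (reflexivity x)          = W.reflexivity x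
        go _ (symmetry x y ε)         = W.symmetry x y ε
        go _ (triangle x y z ε ε′)    = W.triangle x y z ε ε′
        go _ (weakening x y ε ε′ p)   = W.weakening x y ε ε′ p
        go _ (nonexpansive f x y ε)   = W.nonexpansive f x y ε
        go _ (continuity Γ t s ε h)   = W.continuity Γ t s ε λ ε′ p → go _ (h ε′ p)
        go _ (substitution σ φ p)     = W.substitution σ φ (go φ p)
        go _ (assumption Γ φ p)       = W.assumption Γ φ p
        go _ (cut Γ Θ ψ h p)          = W.cut Γ Θ ψ (λ φ q → go _ (h φ q)) (go _ p)

record Schema (S : Signature) : Set₁ where
  field
    {n}        : ℕ
    x y        : Fin n → V
    t s        : Term S V
    f          : (Fin n → ℝ≥0) → ℝ≥0
    continuous : Continuousᶠ f

  Instance : Pred (Conditional S) 0ℓ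
  Instance φ = ∃ λ (εs : Fin n → ℚ≥0) → ∃ λ ε →
    real (f (λ i → ↑ℝ εs i)) ≤∞ ↑ ε × φ ≡ (varEqs x y εs ⊢ t ≐[ ε ] s)

record IsContinuous {S : Signature} (U : Theory S) : Set₁ where
  field
    Index       : Set
    schema      : Index → Schema S
    axiomatizes : Axiomatizes (λ φ → ∃ λ i → Schema.Instance (schema i) φ) U

infixr 6 _⊎ₛ_
_⊎ₛ_ : Signature → Signature → Signature
S ⊎ₛ S′ = record
  { Op = Op S ⊎ Op S′
  ; ar = λ { (inj₁ f) → ar S f ; (inj₂ f) → ar S′ f }
  }

inlₜ : ∀ {S S′ X} → Term S X → Term (S ⊎ₛ S′) X
inlₜ = fold (λ f → node (inj₁ f)) var

inrₜ : ∀ {S S′ X} → Term S′ X → Term (S ⊎ₛ S′) X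
inrₜ = fold (λ f → node (inj₂ f)) var

data SumAxiom {S S′} (U : Theory S) (U′ : Theory S′) : Pred (Conditional (S ⊎ₛ S′)) 0ℓ where
  inl : ∀ φ → Holds U φ → SumAxiom U U′ (mapCond inlₜ φ)
  inr : ∀ φ → Holds U′ φ → SumAxiom U U′ (mapCond inrₜ φ)

_+ₜ_ : ∀ {S S′} → Theory S → Theory S′ → Theory (S ⊎ₛ S′)
U +ₜ U′ = generated (SumAxiom U U′)

-- Translating terms along a reading of the operations of S as operations on
-- S′-terms; inlₜ and inrₜ are instances.
module _ {S S′ : Signature}
         (con : ∀ {X} (f : Op S) → Vec (Term S′ X) (ar S f) → Term S′ X)
         (con-[] : ∀ {X Y} (σ : X → Term S′ Y) f ts → con f ts [ σ ] ≡ con f (folds node σ ts)) where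
  private
    tr : ∀ {X} → Term S X → Term S′ X
    tr = fold con var

    tr-[] : ∀ {X Y} (σ : X → Term S Y) t → tr (t [ σ ]) ≡ tr t [ tr ∘ σ ]
    trs-[] : ∀ {X Y n} (σ : X → Term S Y) (ts : Vec (Term S X) n) →
             folds con var (folds node σ ts) ≡ folds node (tr ∘ σ) (folds con var ts)
    tr-[] σ (var x)     = refl
    tr-[] σ (node f ts) = trans (cong (con f) (trs-[] σ ts)) (sym (con-[] (tr ∘ σ) f _))
    trs-[] σ []       = refl
    trs-[] σ (t ∷ ts) = cong₂ _∷_ (tr-[] σ t) (trs-[] σ ts)

    tr-Eq : ∀ σ φ → mapEq tr (mapEq (_[ σ ]) φ) ≡ mapEq (_[ tr ∘ σ ]) (mapEq tr φ)
    tr-Eq σ (t ≐[ ε ] s) = cong₂ (_≐[ ε ]_) (tr-[] σ t) (tr-[] σ s)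

    tr-Eqs : ∀ σ Γ → List.map (mapEq tr) (List.map (mapEq (_[ σ ])) Γ) ≡
                     List.map (mapEq (_[ tr ∘ σ ])) (List.map (mapEq tr) Γ)
    tr-Eqs σ []      = refl
    tr-Eqs σ (φ ∷ Γ) = cong₂ _∷_ (tr-Eq σ φ) (tr-Eqs σ Γ)

    tr-varEqs : ∀ {n} (x y : Fin n → V) ε → varEqs x y ε ≡ List.map (mapEq tr) (varEqs x y ε)
    tr-varEqs {n} x y ε = sym (Listₚ.map-tabulate {n = n} _ _)

    tr-node : ∀ f (x : Fin (ar S f) → V) →
              con f (Vec.tabulate (var ∘ x)) ≡ tr (node f (Vec.tabulate (var ∘ x)))
    tr-node f x = cong (con f) (sym (folds-tabulate con var x))

  reflectTheory : (W : Theory S′) →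
    (∀ f (x y : Fin (ar S f) → V) ε →
      Holds W (varEqs x y (λ _ → ε) ⊢
        con f (Vec.tabulate (var ∘ x)) ≐[ ε ] con f (Vec.tabulate (var ∘ y)))) →
    Theory S
  reflectTheory W con-nonexpansive = record
    { Holds = λ φ → Holds W (mapCond tr φ)
    ; isTheory = record
      { reflexivity = W.reflexivity
      ; symmetry = W.symmetry
      ; triangle = W.triangle
      ; weakening = W.weakening
      ; nonexpansive = λ f x y ε → subst (Holds W)
          (cong₂ _⊢_ (tr-varEqs x y _) (cong₂ (_≐[ ε ]_) (tr-node f x) (tr-node f y)))
          (con-nonexpansive f x y ε)
      ; continuity = λ Γ t s ε → W.continuity _ _ _ ε
      ; substitution = λ { σ (Γ ⊢ φ) p → subst (Holds W)
          (sym (cong₂ _⊢_ (tr-Eqs σ Γ) (tr-Eq σ φ))) (W.substitution (tr ∘ σ) _ p) }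
      ; assumption = λ Γ φ p → W.assumption _ _ (∈-map⁺ (mapEq tr) p)
      ; cut = λ Γ Θ ψ h p → W.cut _ _ _
          (λ φ φ∈ → let (φ′ , φ′∈Θ , eq) = ∈-map⁻ (mapEq tr) φ∈ in
                    subst (λ φ → Holds W (_ ⊢ φ)) (sym eq) (h φ′ φ′∈Θ)) p
      }
    }
    where module W = Theory W

  translateSchema : Schema S → Schema S′
  translateSchema σ = record
    { x = σ.x ; y = σ.y ; t = tr σ.t ; s = tr σ.s ; f = σ.f ; continuous = σ.continuous }
    where module σ = Schema σ

  translate-instance : ∀ σ {φ} → Schema.Instance σ φ →
                       Schema.Instance (translateSchema σ) (mapCond tr φ)
  translate-instance σ (εs , ε , f≤ε , refl) =
    εs , ε , f≤ε , cong (_⊢ _) (sym (tr-varEqs (Schema.x σ) (Schema.y σ) εs))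

  translate-instance⁻ : ∀ σ {φ} → Schema.Instance (translateSchema σ) φ →
                        ∃ λ ψ → Schema.Instance σ ψ × φ ≡ mapCond tr ψ
  translate-instance⁻ σ (εs , ε , f≤ε , refl) =
    _ , (εs , ε , f≤ε , refl) , cong (_⊢ _) (tr-varEqs (Schema.x σ) (Schema.y σ) εs)

module _ {S S′ : Signature} {U : Theory S} {U′ : Theory S′} where

  +ₜ-continuous : IsContinuous U → IsContinuous U′ → IsContinuous (U +ₜ U′)
  +ₜ-continuous c c′ = record
    { Index = c.Index ⊎ c′.Index
    ; schema = schema
    ; axiomatizes = record { contains = contains ; least = least }
    }
    where
      module c = IsContinuous c
      module c′ = IsContinuous c′

      con₁ : ∀ {X} (f : Op S) → Vec (Term (S ⊎ₛ S′) X) (ar S f) → Term (S ⊎ₛ S′) X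
      con₁ f = node (inj₁ f)
      con₂ : ∀ {X} (f : Op S′) → Vec (Term (S ⊎ₛ S′) X) (ar S′ f) → Term (S ⊎ₛ S′) X
      con₂ f = node (inj₂ f)

      schema : c.Index ⊎ c′.Index → Schema (S ⊎ₛ S′)
      schema (inj₁ i) = translateSchema con₁ (λ _ _ _ → refl) (c.schema i)
      schema (inj₂ i) = translateSchema con₂ (λ _ _ _ → refl) (c′.schema i)

      reflect₁ : Theory (S ⊎ₛ S′) → Theory S
      reflect₁ W = reflectTheory con₁ (λ _ _ _ → refl) W (λ f → Theory.nonexpansive W (inj₁ f))
      reflect₂ : Theory (S ⊎ₛ S′) → Theory S′
      reflect₂ W = reflectTheory con₂ (λ _ _ _ → refl) W (λ f → Theory.nonexpansive W (inj₂ f))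

      Instances : Pred (Conditional (S ⊎ₛ S′)) 0ℓ
      Instances φ = ∃ λ i → Schema.Instance (schema i) φ

      least : ∀ W → (∀ φ → Instances φ → Holds W φ) → ∀ φ → Holds (U +ₜ U′) φ → Holds W φ
      least W h = Axiomatizes.least (generated-axiomatized (SumAxiom U U′)) W λ where
        _ (inl φ p) → Axiomatizes.least c.axiomatizes (reflect₁ W)
          (λ { ψ (i , q) → h _ (inj₁ i , translate-instance con₁ (λ _ _ _ → refl) (c.schema i) q) }) φ p
        _ (inr φ p) → Axiomatizes.least c′.axiomatizes (reflect₂ W)
          (λ { ψ (i , q) → h _ (inj₂ i , translate-instance con₂ (λ _ _ _ → refl) (c′.schema i) q) }) φ p

      contains : ∀ φ → Instances φ → Holds (U +ₜ U′) φ
      contains φ (inj₁ i , p) =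
        let (ψ , q , eq) = translate-instance⁻ con₁ (λ _ _ _ → refl) (c.schema i) p
        in subst (Derivable _) (sym eq) (axiom _ (inl ψ (Axiomatizes.contains c.axiomatizes ψ (i , q))))
      contains φ (inj₂ i , p) =
        let (ψ , q , eq) = translate-instance⁻ con₂ (λ _ _ _ → refl) (c′.schema i) p
        in subst (Derivable _) (sym eq) (axiom _ (inr ψ (Axiomatizes.contains c′.axiomatizes ψ (i , q))))

record Algebra (S : Signature) : Set₁ where
  field
    space : Metric
    op    : ∀ f → NonExpansive (Power space (ar S f)) space
  open Metric space public

  eval : ∀ {X} → (X → Carrier) → Term S X → Carrier
  eval = fold (λ f → fun (op f))

  _at_ : Equation S → (V → Carrier) → Set
  (t ≐[ ε ] s) at ι = dist (eval ι t) (eval ι s) ≼ ε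
open Algebra public using (space; op)

infix 4 _⊨_
_⊨_ : ∀ {S} → Algebra S → Conditional S → Set
A ⊨ (Γ ⊢ φ) = ∀ ι → (∀ ψ → ψ ∈ Γ → ψ at ι) → φ at ι
  where open Algebra A

record Hom {S : Signature} (A B : Algebra S) : Set where
  private
    module A = Algebra A
    module B = Algebra B
  field
    map       : NonExpansive A.space B.space
    preserves : ∀ f as → fun map (fun (op A f) as) B.≈ fun (op B f) (Vec.map (fun map) as)
open Hom public using (map; preserves)

module _ (S : Signature) where
  open Category Met

  private
    idHom : {A : Algebra S} → Hom A A
    idHom {A} = record
      { map = id
      ; preserves = λ f as → resp (op A f) λ i →
          ≈.reflexive (cong (λ v → Vec.lookup v i) (sym (Vecₚ.map-id as)))
      }
      where module ≈ = IsEquivalence (Metric.isEquivalence (space A))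

    compose : {A B C : Algebra S} → Hom B C → Hom A B → Hom A C
    compose {A} {B} {C} g f = record
      { map = map g ∙ map f
      ; preserves = λ o as → ≈.trans (resp (map g) (preserves f o as))
          (≈.trans (preserves g o _) (≈.reflexive
            (cong (fun (op C o)) (sym (Vecₚ.map-∘ (fun (map g)) (fun (map f)) as)))))
      }
      where module ≈ = IsEquivalence (Metric.isEquivalence (space C))

  Algebras : Category (lsuc 0ℓ) 0ℓ 0ℓ
  Algebras = record
    { Obj = Algebra S
    ; _⇒_ = Hom
    ; _≈_ = λ f g → map f ≈ map g
    ; id = idHom
    ; _∙_ = compose
    ; equiv = λ {A} {B} → record
      { refl = λ x → Metric.≈-refl (space B)
      ; sym = λ p x → Metric.≈-sym (space B) (p x)
      ; trans = λ p q x → Metric.≈-trans (space B) (p x) (q x)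
      }
    ; identityˡ = λ {A} {B} x → Metric.≈-refl (space B)
    ; identityʳ = λ {A} {B} x → Metric.≈-refl (space B)
    ; assoc = λ {A} {B} {C} {D} x → Metric.≈-refl (space D)
    ; ∙-cong = λ {_} {_} {C} {f} {f′} p q x → Metric.≈-trans (space C) (resp (map f) (q x)) (p _)
    }

Models : ∀ {S} → Theory S → Algebra S → Set
Models U A = ∀ φ → Holds U φ → A ⊨ φ

𝕂 : ∀ {S} → Theory S → Category (lsuc 0ℓ) 0ℓ 0ℓ
𝕂 {S} U = FullSubcategory (Algebras S) (Models U)

ℂ𝕂 : ∀ {S} → Theory S → Category (lsuc 0ℓ) 0ℓ 0ℓ
ℂ𝕂 U = FullSubcategory (𝕂 U) λ (A , _) → Complete (space A)

forgetful : ∀ {S} (U : Theory S) → Functor (ℂ𝕂 U) CMet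
forgetful U = record
  { F₀ = λ ((A , _) , complete) → space A , complete
  ; F₁ = map
  ; F-cong = λ p → p
  ; F-id = λ {A} x → Metric.≈-refl (space (proj₁ (proj₁ A)))
  ; F-∙ = λ {_} {_} {C} x → Metric.≈-refl (space (proj₁ (proj₁ C)))
  }

module _ {S} (A : Algebra S) where
  open Algebra A

  eval-nonexp : ∀ {X p} (ι κ : X → Carrier) → (∀ x → dist (ι x) (κ x) ≼ p) →
                ∀ t → dist (eval ι t) (eval κ t) ≼ p
  evals-nonexp : ∀ {X p n} (ι κ : X → Carrier) → (∀ x → dist (ι x) (κ x) ≼ p) →
                 ∀ (ts : Vec (Term S X) n) i →
                 dist (Vec.lookup (folds (λ f → fun (op A f)) ι ts) i)
                      (Vec.lookup (folds (λ f → fun (op A f)) κ ts) i) ≼ p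
  eval-nonexp ι κ h (var x)     = h x
  eval-nonexp ι κ h (node f ts) = nonexp (op A f) _ _ (evals-nonexp ι κ h ts)
  evals-nonexp ι κ h (t ∷ ts) Fin.zero    = eval-nonexp ι κ h t
  evals-nonexp ι κ h (t ∷ ts) (Fin.suc i) = evals-nonexp ι κ h ts i

  satisfied : Theory S
  satisfied = record
    { Holds = A ⊨_
    ; isTheory = record
      { reflexivity = λ x ι h → ≈⇒≼ ≈-refl
      ; symmetry = λ x y ε ι h → ≼-sym (h _ (here refl))
      ; triangle = λ x y z ε ε′ ι h → ≼-trans (h _ (here refl)) (h _ (there (here refl)))
      ; weakening = λ x y ε ε′ _ ι h → ≼-upto (p≤p+q ε ε′) (h _ (here refl))
      ; nonexpansive = λ f x y ε ι h → nonexp (op A f) _ _ λ i →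
          subst₂ (λ a b → dist a b ≼ ε)
            (sym (lookup-evals ι x i)) (sym (lookup-evals ι y i))
            (h _ (∈-tabulate⁺ i))
      ; continuity = λ Γ t s ε h ι p → closed (dist _ _) λ ε′ ε<ε′ → h ε′ ε<ε′ ι p
      ; substitution = λ { σ (Γ ⊢ (t ≐[ ε ] s)) h ι p →
          subst₂ (λ a b → dist a b ≼ ε) (sym (fold-[] σ ι t)) (sym (fold-[] σ ι s))
            (h (eval ι ∘ σ) λ { (t′ ≐[ ε′ ] s′) q →
              subst₂ (λ a b → dist a b ≼ ε′) (fold-[] σ ι t′) (fold-[] σ ι s′)
                (p _ (∈-map⁺ (mapEq (_[ σ ])) q)) }) }
      ; assumption = λ Γ φ p ι h → h φ p
      ; cut = λ Γ Θ ψ h p ι q → p ι λ φ φ∈Θ → h φ φ∈Θ ι q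
      }
    }
    where
      lookup-evals : ∀ {n} (ι : V → Carrier) (x : Fin n → V) i →
        Vec.lookup (folds (λ f → fun (op A f)) ι (Vec.tabulate (var ∘ x))) i ≡ ι (x i)
      lookup-evals ι x i = trans (cong (λ v → Vec.lookup v i) (folds-tabulate _ ι x))
                                 (Vecₚ.lookup∘tabulate (ι ∘ x) i)

module Free {S : Signature} (U : Theory S) (X : Metric) where
  private
    module U = Theory U
    module X = Metric X

  -- Near t ε s: the bound d(t , s) ≤ ε is forced by the distances of X and by U.
  data Near : Term S X.Carrier → ℚ≥0 → Term S X.Carrier → Set where
    generator : ∀ {x y ε} → X.dist x y ≼ ε → Near (var x) ε (var y)
    rule      : ∀ (σ : V → Term S X.Carrier) Γ φ → Holds U (Γ ⊢ φ) →
                (∀ ψ → ψ ∈ Γ → Near (lhs ψ [ σ ]) (bound ψ) (rhs ψ [ σ ])) →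
                Near (lhs φ [ σ ]) (bound φ) (rhs φ [ σ ])
    limit     : ∀ {t s ε} → (∀ ε′ → ε < ε′ → Near t ε′ s) → Near t ε s

  private
    hyps : ∀ {n} → Vec (Term S X.Carrier) n → Term S X.Carrier → V → Term S X.Carrier
    hyps []       d _       = d
    hyps (t ∷ ts) d zero    = t
    hyps (t ∷ ts) d (suc k) = hyps ts d k

    hyps-left : ∀ {m n} (ts : Vec (Term S X.Carrier) m) (ss : Vec _ n) d i →
                hyps (ts Vec.++ ss) d (toℕ i) ≡ Vec.lookup ts i
    hyps-left (t ∷ ts) ss d Fin.zero    = refl
    hyps-left (t ∷ ts) ss d (Fin.suc i) = hyps-left ts ss d i

    hyps-right : ∀ {m n} (ts : Vec (Term S X.Carrier) m) (ss : Vec _ n) d i →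
                 hyps (ts Vec.++ ss) d (m ℕ.+ toℕ i) ≡ Vec.lookup ss i
    hyps-right []       (s ∷ ss) d Fin.zero    = refl
    hyps-right []       (s ∷ ss) d (Fin.suc i) = hyps-right [] ss d i
    hyps-right (t ∷ ts) ss       d i           = hyps-right ts ss d i

  near-refl : ∀ {t} → Near t 0≥0 t
  near-refl {t} = rule (λ _ → t) [] _ (U.reflexivity 0) λ _ ()

  near-sym : ∀ {t s ε} → Near t ε s → Near s ε t
  near-sym {t} {s} {ε} p = rule (hyps (t ∷ s ∷ []) t) _ _ (U.symmetry 0 1 ε)
    λ { _ (here refl) → p }

  near-trans : ∀ {t s r ε ε′} → Near t ε s → Near s ε′ r → Near t (ε + ε′) r
  near-trans {t} {s} {r} {ε} {ε′} p q =
    rule (hyps (t ∷ r ∷ s ∷ []) t) _ _ (U.triangle 0 1 2 ε ε′)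
      λ { _ (here refl) → p ; _ (there (here refl)) → q }

  near-up : ∀ {t s ε ε′} → ε ≤ ε′ → Near t ε s → Near t ε′ s
  near-up {t} {s} {ε} {ε′} ε≤ε′ p = limit λ ε″ ε′<ε″ →
    let (γ , ε+γ≡ε″) = gap {ε} {ε″} (ℚₚ.≤-<-trans ε≤ε′ ε′<ε″) in
    subst (λ ε → Near t ε s) ε+γ≡ε″
      (rule (hyps (t ∷ s ∷ []) t) _ _ (U.weakening 0 1 ε (rat γ) (0<⁺ γ)) λ { _ (here refl) → p })

  near-node : ∀ f {ts ss ε} → (∀ i → Near (Vec.lookup ts i) ε (Vec.lookup ss i)) →
              Near (node f ts) ε (node f ss)
  near-node f {ts} {ss} {ε} h =
    subst₂ (λ ts ss → Near (node f ts) ε (node f ss)) left right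
      (rule σ _ _ (U.nonexpansive f toℕ (λ i → ar S f ℕ.+ toℕ i) ε) hypotheses)
    where
      σ : V → Term S X.Carrier
      σ = hyps (ts Vec.++ ss) (node f ts)
      hypotheses : ∀ ψ → ψ ∈ varEqs toℕ (λ i → ar S f ℕ.+ toℕ i) (λ _ → ε) →
                   Near (lhs ψ [ σ ]) (bound ψ) (rhs ψ [ σ ])
      hypotheses ψ ψ∈ =
        let (i , ψ≡) = ∈-tabulate⁻ {f = λ i → var (toℕ i) ≐[ ε ] var (ar S f ℕ.+ toℕ i)} ψ∈ in
        subst (λ ψ → Near (lhs ψ [ σ ]) (bound ψ) (rhs ψ [ σ ])) (sym ψ≡)
          (subst₂ (λ t s → Near t ε s)
            (sym (hyps-left ts ss (node f ts) i)) (sym (hyps-right ts ss (node f ts) i)) (h i))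
      left : folds node σ (Vec.tabulate (var ∘ toℕ)) ≡ ts
      left = trans (folds-tabulate node σ toℕ)
        (trans (Vecₚ.tabulate-cong (hyps-left ts ss (node f ts))) (Vecₚ.tabulate∘lookup ts))
      right : folds node σ (Vec.tabulate (λ i → var (ar S f ℕ.+ toℕ i))) ≡ ss
      right = trans (folds-tabulate node σ _)
        (trans (Vecₚ.tabulate-cong (hyps-right ts ss (node f ts))) (Vecₚ.tabulate∘lookup ss))

  algebra : Algebra S
  algebra = record
    { space = metricFromRelation Near near-up limit near-refl near-sym near-trans
    ; op = λ f → record { fun = node f ; nonexp = λ ts ss → near-node f }
    }

  models : Models U algebra
  models (Γ ⊢ φ) p ι h = rule ι Γ φ p h

  insert : NonExpansive X (space algebra)
  insert = record { fun = var ; nonexp = λ x y → generator }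

  module _ (A : Algebra S) (A-models : Models U A) (h : NonExpansive X (space A)) where
    open Algebra A

    extend-nonexp : ∀ {t s ε} → Near t ε s → dist (eval (fun h) t) (eval (fun h) s) ≼ ε
    extend-nonexp (generator p)    = nonexp h _ _ p
    extend-nonexp (rule σ Γ φ p q) =
      subst₂ (λ a b → dist a b ≼ bound φ)
        (sym (fold-[] σ (fun h) (lhs φ))) (sym (fold-[] σ (fun h) (rhs φ)))
        (A-models (Γ ⊢ φ) p (eval (fun h) ∘ σ) λ ψ ψ∈Γ →
          subst₂ (λ a b → dist a b ≼ bound ψ)
            (fold-[] σ (fun h) (lhs ψ)) (fold-[] σ (fun h) (rhs ψ)) (extend-nonexp (q ψ ψ∈Γ)))
    extend-nonexp (limit q)        = closed (dist _ _) λ ε′ ε<ε′ → extend-nonexp (q ε′ ε<ε′)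

    extend : Hom algebra A
    extend = record
      { map = record { fun = eval (fun h) ; nonexp = λ t s → extend-nonexp }
      ; preserves = λ f ts → resp (op A f) λ i →
          IsEquivalence.reflexive isEquivalence
            (cong (λ v → Vec.lookup v i) (folds-map _ (fun h) ts))
      }

  module _ {A : Algebra S} (g g′ : Hom algebra A) where
    open Algebra A

    module _ (agree : ∀ x → fun (map g) (var x) ≈ fun (map g′) (var x)) where
      extend-unique  : ∀ t → fun (map g) t ≈ fun (map g′) t
      extends-unique : ∀ {n} (ts : Vec (Term S X.Carrier) n) i →
        Vec.lookup (Vec.map (fun (map g)) ts) i ≈ Vec.lookup (Vec.map (fun (map g′)) ts) i
      extend-unique (var x)     = agree x
      extend-unique (node f ts) = ≈-trans (preserves g f ts)
        (≈-trans (resp (op A f) (extends-unique ts)) (≈-sym (preserves g′ f ts)))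
      extends-unique (t ∷ ts) Fin.zero    = extend-unique t
      extends-unique (t ∷ ts) (Fin.suc i) = extends-unique ts i

-- A point of the completion is a family of approximations, the one at δ
-- within δ of the point.
module _ (X : Metric) where
  open Metric X

  record Regular : Set where
    field
      approx  : ℚ⁺ → Carrier
      regular : ∀ δ δ′ → dist (approx δ) (approx δ′) ≼ rat δ + rat δ′
  open Regular

  record Close (x : Regular) (ε : ℚ≥0) (y : Regular) : Set where
    constructor close
    field
      apart : ∀ δ δ′ → dist (approx x δ) (approx y δ′) ≼ ε + (rat δ + rat δ′)
  open Close

  private
    up : ∀ {x y p q} → p ≤ q → Close x p y → Close x q y
    up p≤q h = close λ δ δ′ → ≼-upto (ℚₚ.+-mono-≤ p≤q ℚₚ.≤-refl) (apart h δ δ′)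

    closed-under-inf : ∀ {x y p} → (∀ q → p < q → Close x q y) → Close x p y
    closed-under-inf {x} {y} {p} h = close λ δ δ′ → closed⁺ (dist _ _) λ γ →
      ≼-upto (ℚₚ.≤-reflexive (solve 3 (λ p d g → (p :+ g) :+ d := (p :+ d) :+ g)
               refl (value p) (value (rat δ + rat δ′)) (value (rat γ))))
        (apart (h (p + rat γ) (p<p+δ p γ)) δ δ′)
      where open +-*-Solver

    close-refl : ∀ {x} → Close x 0≥0 x
    close-refl {x} = close λ δ δ′ →
      ≼-upto (≤-reflexive (sym (+-identityˡ (rat δ + rat δ′)))) (regular x δ δ′)

    close-sym : ∀ {x y p} → Close x p y → Close y p x
    close-sym {x} {y} {p} h = close λ δ δ′ →
      ≼-upto (≤-reflexive (cong (p +_) (+-comm (rat δ′) (rat δ)))) (≼-sym (apart h δ′ δ))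

    close-trans : ∀ {x y z p q} → Close x p y → Close y q z → Close x (p + q) z
    close-trans {x} {y} {z} {p} {q} h k = close λ δ δ′ → closed₂ (dist _ _) λ γ →
      ≼-upto (ℚₚ.≤-reflexive (solve 5
               (λ p q d d′ g → (p :+ (d :+ g)) :+ (q :+ (g :+ d′)) := ((p :+ q) :+ (d :+ d′)) :+ (g :+ g))
               refl (value p) (value q) (value (rat δ)) (value (rat δ′)) (value (rat γ))))
        (≼-trans (apart h δ γ) (apart k γ δ′))
      where open +-*-Solver

  completion : Metric
  completion =
    metricFromRelation Close up closed-under-inf close-refl close-sym close-trans
open Regular public
open Close public

opaque
  1/suc : ℕ → ℚ⁺
  1/suc n = mk⁺ (mk≥0 q (ℚ.*≤* (ℤ.+≤+ ℕ.z≤n))) (ℚ.*<* (ℤ.+<+ (ℕ.s≤s ℕ.z≤n)))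
    where
      q : ℚ
      q = mkℚ (ℤ.+ 1) n (1-coprimeTo (suc n))

  archimedean : ∀ (ε : ℚ⁺) → ∃ λ N → ∀ n → N ℕ.≤ n → rat (1/suc n) ≤ rat ε
  archimedean ε = go (value (rat ε)) (ℚ.positive (0<⁺ ε))
    where
      go : ∀ q → ℚ.Positive q → ∃ λ N → ∀ n → N ℕ.≤ n → value (rat (1/suc n)) ℚ.≤ q
      go (mkℚ ℤ.+[1+ a ] d _) _ = d , λ n d≤n → ℚ.*≤* (ℤ.+≤+ (begin
        1 ℕ.* suc d          ≡⟨ ℕₚ.*-identityˡ (suc d) ⟩
        suc d                ≤⟨ ℕ.s≤s d≤n ⟩
        suc n                ≤⟨ ℕₚ.m≤m+n (suc n) (a ℕ.* suc n) ⟩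
        suc a ℕ.* suc n      ∎))
        where open ℕₚ.≤-Reasoning

module _ (X : Metric) where
  open Metric X

  point : NonExpansive X (completion X)
  point = record
    { fun = λ x → record { approx = λ _ → x ; regular = λ δ δ′ → ≈⇒≼ ≈-refl }
    ; nonexp = λ x y {p} xy → close λ δ δ′ → ≼-upto (p≤p+q p (rat δ + rat δ′)) xy
    }

  point-close : ∀ (x : Regular X) δ → Metric.dist (completion X) (fun point (approx x δ)) x ≼ rat δ
  point-close x δ = close λ γ γ′ → ≼-upto
    (ℚₚ.+-mono-≤ (ℚₚ.≤-refl {value (rat δ)})
            (subst (rat γ′ ≤_) (+-comm (rat γ′) (rat γ)) (p≤p+q (rat γ′) (rat γ))))
    (regular x δ γ′)

  completion-complete : Complete (completion X)
  completion-complete s cauchy = l , λ ε → N (half ε) , converges ε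
    where
      module C = Metric (completion X)

      N : ℚ⁺ → ℕ
      N ε = proj₁ (cauchy ε)

      near : ∀ α β m → N α ℕ.≤ m → C.dist (s m) (s (N β)) ≼ rat α + rat β
      near α β m Nα≤m = C.≼-trans
        (proj₂ (cauchy α) m (m ℕ.⊔ N β) Nα≤m (ℕₚ.≤-trans Nα≤m (ℕₚ.m≤m⊔n m (N β))))
        (proj₂ (cauchy β) (m ℕ.⊔ N β) (N β) (ℕₚ.m≤n⊔m m (N β)) ℕₚ.≤-refl)

      l : Regular X
      l = record
        { approx = λ δ → approx (s (N (half δ))) (half δ)
        ; regular = λ δ δ′ → ≼-upto
            (≤-reflexive (trans
              (interchange (rat (half δ)) (rat (half δ′)))
              (cong₂ _+_ (half+half δ) (half+half δ′))))
            (apart (near (half δ) (half δ′) (N (half δ)) ℕₚ.≤-refl) (half δ) (half δ′))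
        }
        where
          interchange : ∀ a b → (a + b) + (a + b) ≡ (a + a) + (b + b)
          interchange a b = value-injective
            (solve 2 (λ a b → (a :+ b) :+ (a :+ b) := (a :+ a) :+ (b :+ b)) refl (value a) (value b))
            where open +-*-Solver

      converges : ∀ ε n → N (half ε) ℕ.≤ n → C.dist (s n) l ≼ rat ε
      converges ε n N≤n = close λ δ δ′ → ≼-upto
        (subst (_≤ rat ε + (rat δ + rat δ′))
          (rearrange (rat (half ε)) (rat δ) (rat (half δ′)) (rat (half δ′)) (half+half δ′))
          (ℚₚ.+-mono-≤ (subst (rat (half ε) ≤_) (half+half ε) (p≤p+q (rat (half ε)) (rat (half ε))))
                  (ℚₚ.≤-refl {value (rat δ + rat δ′)})))
        (apart (near (half ε) (half δ′) n N≤n) δ (half δ′))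
        where
          rearrange : ∀ e d a b {c} → a + b ≡ c → e + (d + c) ≡ (e + a) + (d + b)
          rearrange e d a b refl = value-injective
            (solve 4 (λ e d a b → e :+ (d :+ (a :+ b)) := (e :+ a) :+ (d :+ b)) refl
              (value e) (value d) (value a) (value b))
            where open +-*-Solver

  dense : ∀ {Y} (k k′ : NonExpansive (completion X) Y) →
          (∀ x → Metric._≈_ Y (fun k (fun point x)) (fun k′ (fun point x))) →
          ∀ x → Metric._≈_ Y (fun k x) (fun k′ x)
  dense {Y} k k′ agree x = Y.≼0⇒≈ (closed₂ (Y.dist _ _) λ γ →
    Y.≼-upto (≤-reflexive (sym (+-identityˡ (rat γ + rat γ))))
      (Y.≼-trans
        (Y.≼-sym (nonexp k _ _ (point-close x γ)))
        (Y.≼-respˡ (agree (approx x γ)) (nonexp k′ _ _ (point-close x γ)))))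
    where module Y = Metric Y

  module _ (complete : Complete X) where
    private
      limit-of : ∀ (x : Regular X) → ∃ λ l → ∀ δ → dist (approx x δ) l ≼ rat δ
      limit-of x = l , λ δ → closed₂ (dist _ _) λ γ →
        let (N , s→l) = convergent γ
            (M , small) = archimedean γ
            n = N ℕ.⊔ M
        in ≼-upto
             (subst (rat δ + rat (1/suc n) + rat γ ≤_) (+-assoc (rat δ) (rat γ) (rat γ))
               (ℚₚ.+-mono-≤ (ℚₚ.+-mono-≤ (ℚₚ.≤-refl {value (rat δ)}) (small n (ℕₚ.m≤n⊔m N M)))
                       (ℚₚ.≤-refl {value (rat γ)})))
             (≼-trans (regular x δ (1/suc n)) (s→l n (ℕₚ.m≤m⊔n N M)))
        where
          s : ℕ → Carrier
          s n = approx x (1/suc n)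
          s-cauchy : IsCauchy X s
          s-cauchy ε =
            let (N , small) = archimedean (half ε) in N , λ m n N≤m N≤n →
              ≼-upto (subst (rat (1/suc m) + rat (1/suc n) ≤_) (half+half ε)
                       (ℚₚ.+-mono-≤ (small m N≤m) (small n N≤n)))
                     (regular x (1/suc m) (1/suc n))
          l = proj₁ (complete s s-cauchy)
          convergent = proj₂ (complete s s-cauchy)

    lim : NonExpansive (completion X) X
    lim = record
      { fun = λ x → proj₁ (limit-of x)
      ; nonexp = λ x y {p} xy → closed₄ (dist _ _) λ γ →
          ≼-upto (≤-reflexive (rearrange p (rat γ)))
            (≼-trans (≼-trans (≼-sym (proj₂ (limit-of x) γ)) (apart xy γ γ)) (proj₂ (limit-of y) γ))
      }
      where
        rearrange : ∀ p g → (g + (p + (g + g))) + g ≡ p + ((g + g) + (g + g))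
        rearrange p g = value-injective
          (solve 2 (λ p g → (g :+ (p :+ (g :+ g))) :+ g := p :+ ((g :+ g) :+ (g :+ g))) refl
            (value p) (value g))
          where open +-*-Solver

    lim-close : ∀ (x : Regular X) δ → dist (approx x δ) (fun lim x) ≼ rat δ
    lim-close x = proj₂ (limit-of x)

    lim-constant : ∀ (x : Regular X) a → (∀ δ → approx x δ ≡ a) → fun lim x ≈ a
    lim-constant x a x≡a = ≼0⇒≈ (closed⁺ (dist _ _) λ γ →
      ≼-upto (≤-reflexive (sym (+-identityˡ (rat γ))))
        (≼-sym (subst (λ b → dist b (fun lim x) ≼ rat γ) (x≡a γ) (lim-close x γ))))

completion-map : ∀ {X Y} → NonExpansive X Y → NonExpansive (completion X) (completion Y)
completion-map f = record
  { fun = λ x → record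
    { approx = λ δ → fun f (approx x δ)
    ; regular = λ δ δ′ → nonexp f _ _ (regular x δ δ′)
    }
  ; nonexp = λ x y xy → close λ δ δ′ → nonexp f _ _ (apart xy δ δ′)
  }

module _ {S : Signature} (A : Algebra S) where
  open Algebra A

  private
    approxs : ∀ {n} → ℚ⁺ → Vec (Regular (space A)) n → Vec Carrier n
    approxs δ = Vec.map (λ x → approx x δ)

    approxs-dist : ∀ {n} δ δ′ (xs ys : Vec (Regular (space A)) n) {p} →
      (∀ i → dist (approx (Vec.lookup xs i) δ) (approx (Vec.lookup ys i) δ′) ≼ p) →
      Metric.dist (Power (space A) n) (approxs δ xs) (approxs δ′ ys) ≼ p
    approxs-dist δ δ′ xs ys {p} h i = subst₂ (λ a b → dist a b ≼ p)
      (sym (Vecₚ.lookup-map i _ xs)) (sym (Vecₚ.lookup-map i _ ys)) (h i)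

  completeAlgebra : Algebra S
  completeAlgebra = record
    { space = completion (space A)
    ; op = λ f → record
      { fun = λ xs → record
        { approx = λ δ → fun (op A f) (approxs δ xs)
        ; regular = λ δ δ′ → nonexp (op A f) _ _
            (approxs-dist δ δ′ xs xs λ i → regular (Vec.lookup xs i) δ δ′)
        }
      ; nonexp = λ xs ys h → close λ δ δ′ → nonexp (op A f) _ _
          (approxs-dist δ δ′ xs ys λ i → apart (h i) δ δ′)
      }
    }

  private module C = Algebra completeAlgebra

  pointHom : Hom A completeAlgebra
  pointHom = record
    { map = point (space A)
    ; preserves = λ f as → C.≼0⇒≈ (close λ δ δ′ → ≈⇒≼ (IsEquivalence.reflexive isEquivalence
        (cong (fun (op A f)) (sym (trans (sym (Vecₚ.map-∘ _ _ as)) (Vecₚ.map-id as))))))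
    }

  approx-eval  : ∀ {X} δ (ι : X → C.Carrier) t →
                 approx (C.eval ι t) δ ≡ eval (λ x → approx (ι x) δ) t
  approx-evals : ∀ {X n} δ (ι : X → C.Carrier) (ts : Vec (Term S X) n) →
                 approxs δ (folds (λ f → fun (op completeAlgebra f)) ι ts) ≡
                 folds (λ f → fun (op A f)) (λ x → approx (ι x) δ) ts
  approx-eval δ ι (var x)     = refl
  approx-eval δ ι (node f ts) = cong (fun (op A f)) (approx-evals δ ι ts)
  approx-evals δ ι []       = refl
  approx-evals δ ι (t ∷ ts) = cong₂ _∷_ (approx-eval δ ι t) (approx-evals δ ι ts)

  module _ (σ : Schema S) (A-models : ∀ φ → Schema.Instance σ φ → A ⊨ φ) where
    open Schema σ using (n; x; y; t; s; f; continuous)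

    complete-schema : ∀ φ → Schema.Instance σ φ → completeAlgebra ⊨ φ
    complete-schema _ (εs , ε , f≤ε , refl) ι h =
      close λ δ δ′ → closed₄ (dist _ _) λ γ → at-precision δ δ′ γ
      where
      at-precision : ∀ δ δ′ γ → dist (approx (C.eval ι t) δ) (approx (C.eval ι s) δ′) ≼
                           (ε + (rat δ + rat δ′)) + ((rat γ + rat γ) + (rat γ + rat γ))
      at-precision δ δ′ γ = ≼-upto bound≤ (≼-trans
        (≼-trans (to-ι₀ t δ)
          (A-models _ (εs⁺ , ε + rat γ , (λ ≤q → upward (real fy) ≤q fy≤) , refl) ι₀ hyps))
        (from-ι₀ s δ′))
        where
        x₀ : Fin n → ℝ≥0
        x₀ i = ↑ℝ εs i

        η = proj₁ (continuous x₀ γ)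

        εs⁺ : Fin n → ℚ≥0
        εs⁺ i = εs i + rat η

        fy : ℝ≥0
        fy = f (λ i → ↑ℝ εs⁺ i)

        fy≤ : real fy ≼ ε + rat γ
        fy≤ = proj₂ (proj₂ (continuous x₀ γ) (λ i → ↑ℝ εs⁺ i) λ i →
                (λ {q} h → closed (↑ εs i) {q} λ q′ q<q′ →
                  let (a , b , ≤a , _ , a+b≤q′) = h q′ q<q′ in
                  ℚₚ.≤-trans (p≤p+q (εs i) (rat η)) (ℚₚ.≤-trans ≤a
                    (ℚₚ.≤-trans (p≤p+q a b) a+b≤q′))) ,
                (λ {q} h → closed (↑ εs⁺ i) {q} λ q′ q<q′ →
                  let (a , b , ≤a , ≤b , a+b≤q′) = h q′ q<q′ in
                  ℚₚ.≤-trans (ℚₚ.+-mono-≤ ≤a ≤b) a+b≤q′))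
              (λ q <q → ε , rat γ , f≤ε (ℚₚ.≤-refl {value ε}) , ℚₚ.≤-refl , ℚₚ.<⇒≤ <q)

        smaller : ∃ λ δ₀ → rat δ₀ ≤ rat (half η) × rat δ₀ ≤ rat γ
        smaller with ℚₚ.≤-total (value (rat (half η))) (value (rat γ))
        ... | inj₁ le = half η , ℚₚ.≤-refl , le
        ... | inj₂ le = γ , le , ℚₚ.≤-refl

        δ₀ = proj₁ smaller

        ι₀ : V → Carrier
        ι₀ v = approx (ι v) δ₀

        hyps : ∀ ψ → ψ ∈ varEqs x y εs⁺ → ψ at ι₀
        hyps ψ ψ∈ =
          let (i , ψ≡) = ∈-tabulate⁻ {f = λ i → var (x i) ≐[ εs⁺ i ] var (y i)} ψ∈ in
          subst (_at ι₀) (sym ψ≡)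
            (≼-upto (ℚₚ.+-mono-≤ (ℚₚ.≤-refl {value (εs i)})
                       (subst (rat δ₀ + rat δ₀ ≤_) (half+half η)
                         (ℚₚ.+-mono-≤ (proj₁ (proj₂ smaller)) (proj₁ (proj₂ smaller)))))
              (apart (h _ (∈-tabulate⁺ i)) δ₀ δ₀))

        from-ι₀ : ∀ r β → dist (eval ι₀ r) (approx (C.eval ι r) β) ≼ rat δ₀ + rat β
        from-ι₀ r β = subst (λ a → dist a (approx (C.eval ι r) β) ≼ rat δ₀ + rat β)
          (approx-eval δ₀ ι r) (regular (C.eval ι r) δ₀ β)

        to-ι₀ : ∀ r α → dist (approx (C.eval ι r) α) (eval ι₀ r) ≼ rat α + rat δ₀
        to-ι₀ r α = subst (λ a → dist (approx (C.eval ι r) α) a ≼ rat α + rat δ₀)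
          (approx-eval δ₀ ι r) (regular (C.eval ι r) α δ₀)

        bound≤ : (rat δ + rat δ₀) + (ε + rat γ) + (rat δ₀ + rat δ′) ≤
                 (ε + (rat δ + rat δ′)) + ((rat γ + rat γ) + (rat γ + rat γ))
        bound≤ = subst (ℚ._≤ value ((ε + (rat δ + rat δ′)) + ((rat γ + rat γ) + (rat γ + rat γ))))
          (solve 5
            (λ d d′ e g z → (e :+ (d :+ d′)) :+ (g :+ (z :+ z)) := ((d :+ z) :+ (e :+ g)) :+ (z :+ d′))
            refl (value (rat δ)) (value (rat δ′)) (value ε) (value (rat γ)) (value (rat δ₀)))
          (ℚₚ.+-mono-≤ (ℚₚ.≤-refl {value (ε + (rat δ + rat δ′))})
            (ℚₚ.+-mono-≤ (p≤p+q (rat γ) (rat γ)) (ℚₚ.+-mono-≤ (proj₂ (proj₂ smaller)) (proj₂ (proj₂ smaller)))))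
          where open +-*-Solver

module _ {S : Signature} (B A : Algebra S) (complete : Complete (space A)) (g : Hom B A) where
  private
    module B = Algebra B
    module A = Algebra A
    open Category Met using (_∙_)

    ĝ : NonExpansive (completion (space B)) (space A)
    ĝ = lim (space A) complete ∙ completion-map (map g)

  extendHom : Hom (completeAlgebra B) A
  extendHom = record
    { map = ĝ
    ; preserves = λ f xs → A.≼0⇒≈ (closed₂ (A.dist _ _) λ δ →
        A.≼-upto (≤-reflexive (sym (+-identityˡ (rat δ + rat δ))))
          (A.≼-trans
            (A.≼-sym (lim-close (space A) complete
              (fun (completion-map (map g)) (fun (op (completeAlgebra B) f) xs)) δ))
            (A.≼-respˡ (preserves g f _) (nonexp (op A f) _ _ λ i →
              subst₂ (λ a b → A.dist a b ≼ rat δ)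
                (sym (trans (Vecₚ.lookup-map i (fun (map g)) (Vec.map (λ x → approx x δ) xs))
                            (cong (fun (map g)) (Vecₚ.lookup-map i (λ x → approx x δ) xs))))
                (sym (Vecₚ.lookup-map i (fun ĝ) xs))
                (lim-close (space A) complete
                  (fun (completion-map (map g)) (Vec.lookup xs i)) δ)))))
    }

lift-models : ∀ {S} {U : Theory S} → IsContinuous U → ∀ A → Models U A → Models U (completeAlgebra A)
lift-models c A A-models = Axiomatizes.least axiomatizes (satisfied (completeAlgebra A))
  λ { φ (i , p) → complete-schema A (schema i)
        (λ ψ q → A-models ψ (Axiomatizes.contains axiomatizes ψ (i , q))) φ p }
  where open IsContinuous c

-- Opaque, since ℂT is used only through the adjunction.
opaque
  freeComplete : ∀ {S} (U : Theory S) → IsContinuous U → LeftAdjoint (forgetful U)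
  freeComplete {S} U c = fromUniversalArrows (forgetful U) free unit
    (λ {X} {Y} → extend X Y) (λ {X} {Y} → extend-unit X Y) (λ {X} {Y} {g} {h} → unique X Y g h)
    where
      open Category Met using (_∙_)
      open Category (Algebras S) using () renaming (_∙_ to _∙ₕ_)
      module CMet = Category CMet
      module ℂ𝕂 = Category (ℂ𝕂 U)
      open Functor (forgetful U) using (F₀; F₁)

      free : CMet.Obj → ℂ𝕂.Obj
      free (X , _) = (completeAlgebra (Free.algebra U X) ,
                      lift-models c (Free.algebra U X) (Free.models U X)) ,
                     completion-complete (space (Free.algebra U X))

      unit : ∀ X → X CMet.⇒ F₀ (free X)
      unit (X , _) = point (space (Free.algebra U X)) ∙ Free.insert U X

      extend : ∀ X Y → X CMet.⇒ F₀ Y → free X ℂ𝕂.⇒ Y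
      extend (X , _) ((A , A-models) , complete) h =
        extendHom (Free.algebra U X) A complete (Free.extend U X A A-models h)

      extend-unit : ∀ X Y h → CMet._≈_ {X} {F₀ Y}
        (CMet._∙_ {X} {F₀ (free X)} {F₀ Y} (F₁ {free X} {Y} (extend X Y h)) (unit X)) h
      extend-unit (X , X-complete) ((A , A-models) , complete) h x = lim-constant (space A) complete
        (fun (completion-map (map (Free.extend U X A A-models h))) (fun (unit (X , X-complete)) x))
        (fun h x) λ δ → refl

      unique : ∀ X Y (g h : free X ℂ𝕂.⇒ Y) →
        CMet._≈_ {X} {F₀ Y} (CMet._∙_ {X} {F₀ (free X)} {F₀ Y} (F₁ {free X} {Y} g) (unit X))
                            (CMet._∙_ {X} {F₀ (free X)} {F₀ Y} (F₁ {free X} {Y} h) (unit X)) →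
        ℂ𝕂._≈_ {free X} {Y} g h
      unique (X , _) ((A , _) , _) g h agree = dense (space (Free.algebra U X)) (map g) (map h)
        (Free.extend-unique U X (g ∙ₕ pointHom (Free.algebra U X)) (h ∙ₕ pointHom (Free.algebra U X))
          agree)

ℂT : ∀ {S} (U : Theory S) → IsContinuous U → Monad CMet
ℂT U c = inducedMonad (freeComplete U c)

{-# OPTIONS --safe #-}

-- Monad maps ℂT U → M correspond to liftings of M along the forgetful functor
-- of the complete models of U: one way by freeness of ℂT U X, the other because
-- an Eilenberg–Moore algebra of ℂT U is a model of U, the axioms of a continuous
-- theory having only variables in their hypotheses.  A model of U + U′ is a model
-- of U and of U′ on the same space, so a lifting to U + U′ is a pair of liftings
-- to U and to U′, which is the universal property of the coproduct of monads.
module Submission where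

open import Defs
open import Level using (0ℓ)
import Data.Fin.Base as Fin
open import Data.List.Membership.Propositional.Properties
  using (∈-map⁺; ∈-map⁻; ∈-tabulate⁺; ∈-tabulate⁻)
open import Data.Product using (Σ; _,_; proj₁; proj₂)
open import Data.Sum using (inj₁; inj₂)
open import Data.Vec.Base as Vec using (Vec; []; _∷_)
import Data.Vec.Properties as Vecₚ
open import Function.Base using (_∘_)
open import Relation.Binary.Bundles using (Setoid)
open import Relation.Binary.PropositionalEquality
  using (_≡_; refl; sym; trans; cong; cong₂; subst; subst₂)
import Relation.Binary.Reasoning.Setoid as SetoidReasoning

-- Freeness from a unit and counit.

module AdjunctionProperties
  {o ℓ e o′ ℓ′ e′} {C : Category o ℓ e} {D : Category o′ ℓ′ e′}
  {L : Functor C D} {R : Functor D C} (adj : Adjunction L R) where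
  private
    module C = Category C
    module D = Category D
    module L = Functor L
    module R = Functor R
  open Adjunction adj

  -- Since `freeComplete` is opaque, the universal property of its free algebras is recovered from
  -- the unit, the counit and the triangle identities.
  adjunct : ∀ {X Y} → X C.⇒ R.F₀ Y → L.F₀ X D.⇒ Y
  adjunct h = counit.at _ D.∙ L.F₁ h

  adjunct-unit : ∀ {X Y} (h : X C.⇒ R.F₀ Y) → R.F₁ (adjunct h) C.∙ unit.at X C.≈ h
  adjunct-unit h = begin
    R.F₁ (adjunct h) C.∙ unit.at _                          ≈⟨ C.∙-congʳ R.F-∙ ⟩
    (R.F₁ (counit.at _) C.∙ R.F₁ (L.F₁ h)) C.∙ unit.at _    ≈⟨ C.assoc ⟩
    R.F₁ (counit.at _) C.∙ R.F₁ (L.F₁ h) C.∙ unit.at _      ≈⟨ C.∙-congˡ (unit.natural h) ⟨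
    R.F₁ (counit.at _) C.∙ unit.at _ C.∙ h                  ≈⟨ C.sym-assoc ⟩
    (R.F₁ (counit.at _) C.∙ unit.at _) C.∙ h                ≈⟨ C.∙-congʳ zag ⟩
    C.id C.∙ h                                              ≈⟨ C.identityˡ ⟩
    h                                                       ∎
    where open C.HomReasoning

  adjunct-unique : ∀ {X Y} (g : L.F₀ X D.⇒ Y) → adjunct (R.F₁ g C.∙ unit.at X) D.≈ g
  adjunct-unique g = begin
    counit.at _ D.∙ L.F₁ (R.F₁ g C.∙ unit.at _)             ≈⟨ D.∙-congˡ L.F-∙ ⟩
    counit.at _ D.∙ L.F₁ (R.F₁ g) D.∙ L.F₁ (unit.at _)      ≈⟨ D.sym-assoc ⟩
    (counit.at _ D.∙ L.F₁ (R.F₁ g)) D.∙ L.F₁ (unit.at _)    ≈⟨ D.∙-congʳ (counit.natural g) ⟩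
    (g D.∙ counit.at _) D.∙ L.F₁ (unit.at _)                ≈⟨ D.assoc ⟩
    g D.∙ counit.at _ D.∙ L.F₁ (unit.at _)                  ≈⟨ D.∙-congˡ zig ⟩
    g D.∙ D.id                                              ≈⟨ D.identityʳ ⟩
    g                                                       ∎
    where open D.HomReasoning

  -- Both maps are adjuncts of their restrictions to generators. Later equations between
  -- homomorphisms out of a free algebra reduce by this to equations on generators.
  unit-jointly-epi : ∀ {X Y} (g h : L.F₀ X D.⇒ Y) →
    R.F₁ g C.∙ unit.at X C.≈ R.F₁ h C.∙ unit.at X → g D.≈ h
  unit-jointly-epi g h p = D.Eq.trans (D.Eq.sym (adjunct-unique g))
    (D.Eq.trans (D.∙-congˡ (L.F-cong p)) (adjunct-unique h))

-- Operations, term evaluation and homomorphisms up to distance zero.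

setoid : Metric → Setoid 0ℓ 0ℓ
setoid X = record { isEquivalence = Metric.isEquivalence X }

module _ {S : Signature} where

  infixr 9 _∘ₕ_
  _∘ₕ_ : {A B C : Algebra S} → Hom B C → Hom A B → Hom A C
  _∘ₕ_ {A} {B} {C} = Category._∙_ (Algebras S) {A} {B} {C}

  module _ (A : Algebra S) where
    open Algebra A hiding (space; op)

    op-map-cong : ∀ {X : Set} f {g h : X → Carrier} → (∀ x → g x ≈ h x) → ∀ v →
                  fun (op A f) (Vec.map g v) ≈ fun (op A f) (Vec.map h v)
    op-map-cong f g≈h v = resp (op A f) λ i →
      subst₂ _≈_ (sym (Vecₚ.lookup-map i _ v)) (sym (Vecₚ.lookup-map i _ v)) (g≈h _)

    op-map-id : ∀ f {g : Carrier → Carrier} → (∀ x → g x ≈ x) → ∀ v →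
                fun (op A f) (Vec.map g v) ≈ fun (op A f) v
    op-map-id f {g} g≈id v =
      subst (λ w → fun (op A f) (Vec.map g v) ≈ fun (op A f) w) (Vecₚ.map-id v)
        (op-map-cong f g≈id v)

    op-map-map : ∀ {X Y : Set} f (g : Y → Carrier) (h : X → Y) v →
                 fun (op A f) (Vec.map g (Vec.map h v)) ≈ fun (op A f) (Vec.map (g ∘ h) v)
    op-map-map f g h v =
      Setoid.reflexive (setoid (space A)) (cong (fun (op A f)) (sym (Vecₚ.map-∘ g h v)))

    -- The distance-zero case of `eval-nonexp`.
    eval-cong : ∀ {X : Set} {ι κ : X → Carrier} → (∀ x → ι x ≈ κ x) →
                ∀ t → eval ι t ≈ eval κ t
    eval-cong ι≈κ t = ≼0⇒≈ (eval-nonexp A _ _ (λ x → ≈⇒≼ (ι≈κ x)) t)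

  module _ {A B : Algebra S} (g : Hom A B) where
    private
      module A = Algebra A
      module B = Algebra B

    hom-eval  : ∀ {X : Set} (ι : X → A.Carrier) t →
                fun (map g) (A.eval ι t) B.≈ B.eval (fun (map g) ∘ ι) t
    hom-evals : ∀ {X : Set} {n} (ι : X → A.Carrier) (ts : Vec (Term S X) n) i →
      Vec.lookup (Vec.map (fun (map g)) (folds (λ f → fun (op A f)) ι ts)) i B.≈
      Vec.lookup (folds (λ f → fun (op B f)) (fun (map g) ∘ ι) ts) i
    hom-eval ι (var x)     = B.≈-refl
    hom-eval ι (node f ts) = B.≈-trans (preserves g f _) (resp (op B f) (hom-evals ι ts))
    hom-evals ι (t ∷ ts) Fin.zero    = hom-eval ι t
    hom-evals ι (t ∷ ts) (Fin.suc i) = hom-evals ι ts i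

-- Satisfaction under translation of terms.

module _ {S S′ : Signature} (A : Algebra S′)
         (con : ∀ f → Vec (Term S′ V) (ar S f) → Term S′ V)
         (ops : ∀ f → NonExpansive (Power (space A) (ar S f)) (space A))
         (eval-con : ∀ f ι ts → Algebra.eval A ι (con f ts) ≡
                                fun (ops f) (folds (λ f → fun (op A f)) ι ts)) where
  private
    module A = Algebra A

    B : Algebra S
    B = record { space = space A ; op = ops }
    module B = Algebra B

    tr : Term S V → Term S′ V
    tr = fold con var

    eval-tr  : ∀ ι t → A.eval ι (tr t) ≡ B.eval ι t
    evals-tr : ∀ {n} ι (ts : Vec (Term S V) n) →
               folds (λ f → fun (op A f)) ι (folds con var ts) ≡ folds (λ f → fun (op B f)) ι ts
    eval-tr ι (var x)     = refl
    eval-tr ι (node f ts) = trans (eval-con f ι _) (cong (fun (ops f)) (evals-tr ι ts))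
    evals-tr ι []       = refl
    evals-tr ι (t ∷ ts) = cong₂ _∷_ (eval-tr ι t) (evals-tr ι ts)

    at⁺ : ∀ ι ψ → ψ B.at ι → mapEq tr ψ A.at ι
    at⁺ ι (t ≐[ ε ] s) = subst₂ (λ a b → A.dist a b ≼ ε) (sym (eval-tr ι t)) (sym (eval-tr ι s))

    at⁻ : ∀ ι ψ → mapEq tr ψ A.at ι → ψ B.at ι
    at⁻ ι (t ≐[ ε ] s) = subst₂ (λ a b → A.dist a b ≼ ε) (eval-tr ι t) (eval-tr ι s)

  -- The two algebras share a carrier and `tr` fixes variables, so one assignment `ι` serves both
  -- sides and every term has the same value as its translation.
  ⊨-translate⁺ : ∀ φ → B ⊨ φ → A ⊨ mapCond tr φ
  ⊨-translate⁺ (Γ ⊢ φ) B⊨φ ι hyps =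
    at⁺ ι φ (B⊨φ ι λ ψ ψ∈Γ → at⁻ ι ψ (hyps _ (∈-map⁺ (mapEq tr) ψ∈Γ)))

  ⊨-translate⁻ : ∀ φ → A ⊨ mapCond tr φ → B ⊨ φ
  ⊨-translate⁻ (Γ ⊢ φ) A⊨φ ι hyps = at⁻ ι φ (A⊨φ ι λ ψ ψ∈ →
    let (χ , χ∈Γ , ψ≡) = ∈-map⁻ (mapEq tr) ψ∈ in subst (A._at ι) (sym ψ≡) (at⁺ ι χ (hyps χ χ∈Γ)))

-- Models of a sum theory and their reducts.

module _ {S S′ : Signature} where

  reduct₁ : Algebra (S ⊎ₛ S′) → Algebra S
  reduct₁ A = record { space = space A ; op = λ f → op A (inj₁ f) }

  reduct₂ : Algebra (S ⊎ₛ S′) → Algebra S′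
  reduct₂ A = record { space = space A ; op = λ f → op A (inj₂ f) }

  reductHom₁ : ∀ {A B} → Hom A B → Hom (reduct₁ A) (reduct₁ B)
  reductHom₁ g = record { map = map g ; preserves = λ f → preserves g (inj₁ f) }

  reductHom₂ : ∀ {A B} → Hom A B → Hom (reduct₂ A) (reduct₂ B)
  reductHom₂ g = record { map = map g ; preserves = λ f → preserves g (inj₂ f) }

  module _ {U : Theory S} {U′ : Theory S′} (A : Algebra (S ⊎ₛ S′)) where

    reduct₁-models : Models (U +ₜ U′) A → Models U (reduct₁ A)
    reduct₁-models A-models φ p = ⊨-translate⁻ A (λ f → node (inj₁ f)) (λ f → op A (inj₁ f))
      (λ f ι ts → refl) φ (A-models _ (axiom _ (inl φ p)))

    reduct₂-models : Models (U +ₜ U′) A → Models U′ (reduct₂ A)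
    reduct₂-models A-models φ p = ⊨-translate⁻ A (λ f → node (inj₂ f)) (λ f → op A (inj₂ f))
      (λ f ι ts → refl) φ (A-models _ (axiom _ (inr φ p)))

    -- The conditional equations satisfied by `A` form a theory, and `U +ₜ U′` is the least one
    -- containing the translated members of `U` and `U′`; so only these need checking.
    sum-models : Models U (reduct₁ A) → Models U′ (reduct₂ A) → Models (U +ₜ U′) A
    sum-models m m′ = Axiomatizes.least (generated-axiomatized (SumAxiom U U′)) (satisfied A) λ where
      _ (inl φ p) → ⊨-translate⁺ A (λ f → node (inj₁ f)) (λ f → op A (inj₁ f))
                      (λ f ι ts → refl) φ (m φ p)
      _ (inr φ p) → ⊨-translate⁺ A (λ f → node (inj₂ f)) (λ f → op A (inj₂ f))
                      (λ f ι ts → refl) φ (m′ φ p)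

-- Liftings of monads to models, for one theory and for a sum.

-- A lifting of the functor underlying M, and of its multiplication, along the
-- forgetful functor from the models of U.
record Lifting {S : Signature} (U : Theory S) (M : Monad CMet) : Set₁ where
  open Monad M
  field
    ops : ∀ X f → NonExpansive (Power (proj₁ (T₀ X)) (ar S f)) (proj₁ (T₀ X))

  algebra : Category.Obj CMet → Algebra S
  algebra X = record { space = proj₁ (T₀ X) ; op = ops X }

  field
    models : ∀ X → Models U (algebra X)
    T₁-preserves : ∀ {X Y} (h : Category._⇒_ CMet X Y) f as →
      Metric._≈_ (proj₁ (T₀ Y)) (fun (T₁ {X} {Y} h) (fun (ops X f) as))
                                (fun (ops Y f) (Vec.map (fun (T₁ {X} {Y} h)) as))
    μ-preserves : ∀ X f as →
      Metric._≈_ (proj₁ (T₀ X)) (fun (μ.at X) (fun (ops (T₀ X) f) as))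
                                (fun (ops X f) (Vec.map (fun (μ.at X)) as))

  T₁-hom : ∀ X Y (h : Category._⇒_ CMet X Y) → Hom (algebra X) (algebra Y)
  T₁-hom X Y h = record { map = T₁ {X} {Y} h ; preserves = T₁-preserves {X} {Y} h }

  μ-hom : ∀ X → Hom (algebra (T₀ X)) (algebra X)
  μ-hom X = record { map = μ.at X ; preserves = μ-preserves X }

module _ {S S′ : Signature} {U : Theory S} {U′ : Theory S′} {M : Monad CMet} where

  restrict₁ : Lifting (U +ₜ U′) M → Lifting U M
  restrict₁ l = record
    { ops = λ X f → ops X (inj₁ f)
    ; models = λ X → reduct₁-models {U = U} {U′} (algebra X) (models X)
    ; T₁-preserves = λ {X} {Y} h f → T₁-preserves {X} {Y} h (inj₁ f)
    ; μ-preserves = λ X f → μ-preserves X (inj₁ f)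
    }
    where open Lifting l

  restrict₂ : Lifting (U +ₜ U′) M → Lifting U′ M
  restrict₂ l = record
    { ops = λ X f → ops X (inj₂ f)
    ; models = λ X → reduct₂-models {U = U} {U′} (algebra X) (models X)
    ; T₁-preserves = λ {X} {Y} h f → T₁-preserves {X} {Y} h (inj₂ f)
    ; μ-preserves = λ X f → μ-preserves X (inj₂ f)
    }
    where open Lifting l

  -- Each sum axiom and each preservation condition concerns the operations of one summand only, so
  -- the liftings are joined by cases.
  combine : Lifting U M → Lifting U′ M → Lifting (U +ₜ U′) M
  combine l l′ = record
    { ops = ops
    ; models = λ X → sum-models {U = U} {U′} (record { space = proj₁ (T₀ X) ; op = ops X })
                       (Lifting.models l X) (Lifting.models l′ X)
    ; T₁-preserves = λ {X} {Y} h → λ where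
        (inj₁ f) → Lifting.T₁-preserves l {X} {Y} h f
        (inj₂ f) → Lifting.T₁-preserves l′ {X} {Y} h f
    ; μ-preserves = λ where
        X (inj₁ f) → Lifting.μ-preserves l X f
        X (inj₂ f) → Lifting.μ-preserves l′ X f
    }
    where
      open Monad M using (T₀)
      ops : ∀ X f → NonExpansive (Power (proj₁ (T₀ X)) (ar (S ⊎ₛ S′) f)) (proj₁ (T₀ X))
      ops X (inj₁ f) = Lifting.ops l X f
      ops X (inj₂ f) = Lifting.ops l′ X f

-- From liftings to monad maps.

module Induced {S : Signature} (U : Theory S) (c : IsContinuous U) where
  private
    module CMet = Category CMet
    module ℂ𝕂 = Category (ℂ𝕂 U)
    module T = Monad (ℂT U c)
  open LeftAdjoint (freeComplete U c)
  open Adjunction adjunction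
  open AdjunctionProperties adjunction
  private
    module L = Functor left

  -- `T₁` and `μ` of `ℂT U` are images of homomorphisms under the forgetful functor, hence preserve
  -- the operations.
  freeLifting : Lifting U (ℂT U c)
  freeLifting = record
    { ops = λ X → op (proj₁ (proj₁ (L.F₀ X)))
    ; models = λ X → proj₂ (proj₁ (L.F₀ X))
    ; T₁-preserves = λ {X} {Y} h → preserves (L.F₁ {X} {Y} h)
    ; μ-preserves = λ X → preserves (counit.at (L.F₀ X))
    }

  free : CMet.Obj → Algebra S
  free = Lifting.algebra freeLifting

  free-unique : ∀ X (Y : ℂ𝕂.Obj) (g h : Hom (free X) (proj₁ (proj₁ Y))) →
    let open Metric (space (proj₁ (proj₁ Y))) in
    (∀ x → fun (map g) (fun (T.η.at X) x) ≈ fun (map h) (fun (T.η.at X) x)) →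
    ∀ t → fun (map g) t ≈ fun (map h) t
  free-unique X Y = unit-jointly-epi {X} {Y}

  module _ {M : Monad CMet} (l : Lifting U M) where
    open Lifting l
    private
      module M = Monad M

      model : CMet.Obj → ℂ𝕂.Obj
      model X = (algebra X , models X) , proj₂ (M.T₀ X)

    inducedHom : ∀ X → Hom (free X) (algebra X)
    inducedHom X = adjunct {X} {model X} (M.η.at X)

    induced-η : ∀ X x → Metric._≈_ (proj₁ (M.T₀ X))
      (fun (map (inducedHom X)) (fun (T.η.at X) x)) (fun (M.η.at X) x)
    induced-η X = adjunct-unit {X} {model X} (M.η.at X)

    induced-unique : ∀ X (g : Hom (free X) (algebra X)) →
      let open Metric (proj₁ (M.T₀ X)) in
      (∀ x → fun (map g) (fun (T.η.at X) x) ≈ fun (M.η.at X) x) →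
      ∀ t → fun (map g) t ≈ fun (map (inducedHom X)) t
    induced-unique X g g-η = free-unique X (model X) g (inducedHom X) λ x →
      Metric.≈-trans (proj₁ (M.T₀ X)) (g-η x) (Metric.≈-sym (proj₁ (M.T₀ X)) (induced-η X x))

    -- The lifting makes `M.T₁ h` and `M.μ.at X` homomorphisms, so naturality and compatibility with
    -- multiplication are equations between homomorphisms out of a free algebra and are checked on
    -- generators.
    induced : MonadMap (ℂT U c) M
    induced = record
      { transformation = record
        { at = λ X → map (inducedHom X)
        ; natural = λ {X} {Y} h → free-unique X (model Y)
            (inducedHom Y ∘ₕ Lifting.T₁-hom freeLifting X Y h) (T₁-hom X Y h ∘ₕ inducedHom X)
            (natural-η X Y h)
        }
      ; resp-unit = λ {X} → induced-η X
      ; resp-mult = λ {X} → free-unique (T.T₀ X) (model X)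
          (inducedHom X ∘ₕ Lifting.μ-hom freeLifting X)
          (μ-hom X ∘ₕ T₁-hom (T.T₀ X) (M.T₀ X) (map (inducedHom X)) ∘ₕ inducedHom (T.T₀ X))
          (mult-η X)
      }
      where
        natural-η : ∀ X Y (h : X CMet.⇒ Y) x → Metric._≈_ (proj₁ (M.T₀ Y))
          (fun (map (inducedHom Y)) (fun (T.T₁ {X} {Y} h) (fun (T.η.at X) x)))
          (fun (M.T₁ {X} {Y} h) (fun (map (inducedHom X)) (fun (T.η.at X) x)))
        natural-η X Y h x = begin
          fun (map (inducedHom Y)) (fun (T.T₁ {X} {Y} h) (fun (T.η.at X) x))
            ≈⟨ resp (map (inducedHom Y)) (T.η.natural {X} {Y} h x) ⟨
          fun (map (inducedHom Y)) (fun (T.η.at Y) (fun h x))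
            ≈⟨ induced-η Y (fun h x) ⟩
          fun (M.η.at Y) (fun h x)
            ≈⟨ M.η.natural {X} {Y} h x ⟩
          fun (M.T₁ {X} {Y} h) (fun (M.η.at X) x)
            ≈⟨ resp (M.T₁ {X} {Y} h) (induced-η X x) ⟨
          fun (M.T₁ {X} {Y} h) (fun (map (inducedHom X)) (fun (T.η.at X) x)) ∎
          where open SetoidReasoning (setoid (proj₁ (M.T₀ Y)))

        mult-η : ∀ X t → Metric._≈_ (proj₁ (M.T₀ X))
          (fun (map (inducedHom X)) (fun (T.μ.at X) (fun (T.η.at (T.T₀ X)) t)))
          (fun (M.μ.at X) (fun (M.T₁ {T.T₀ X} {M.T₀ X} (map (inducedHom X)))
            (fun (map (inducedHom (T.T₀ X))) (fun (T.η.at (T.T₀ X)) t))))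
        mult-η X t = begin
          fun σ (fun (T.μ.at X) (fun (T.η.at (T.T₀ X)) t))
            ≈⟨ resp σ (T.μ-ηT {X} t) ⟩
          fun σ t
            ≈⟨ M.μ-ηT {X} (fun σ t) ⟨
          fun (M.μ.at X) (fun (M.η.at (M.T₀ X)) (fun σ t))
            ≈⟨ resp (M.μ.at X) (M.η.natural {T.T₀ X} {M.T₀ X} σ t) ⟩
          fun (M.μ.at X) (fun Mσ (fun (M.η.at (T.T₀ X)) t))
            ≈⟨ resp (M.μ.at X) (resp Mσ (induced-η (T.T₀ X) t)) ⟨
          fun (M.μ.at X) (fun Mσ
            (fun (map (inducedHom (T.T₀ X))) (fun (T.η.at (T.T₀ X)) t))) ∎
          where
            open SetoidReasoning (setoid (proj₁ (M.T₀ X)))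
            σ = map (inducedHom X)
            Mσ = M.T₁ {T.T₀ X} {M.T₀ X} σ

  -- Eilenberg-Moore algebras of `ℂT U` as models of `U`.

  module _ (A : CMet.Obj) (a : T.T₀ A CMet.⇒ A) where
    private
      module A = Metric (proj₁ A)

    -- When `a` satisfies the Eilenberg-Moore laws, this is the `S`-algebra structure underlying
    -- `a`.
    actionAlgebra : Algebra S
    actionAlgebra = record
      { space = proj₁ A
      ; op = λ f → record
        { fun = λ xs → fun a (fun (op (free A) f) (Vec.map (fun (T.η.at A)) xs))
        ; nonexp = λ xs ys xs~ys → nonexp a _ _ (nonexp (op (free A) f) _ _ λ i →
            subst₂ (λ x y → Metric.dist (space (free A)) x y ≼ _)
              (sym (Vecₚ.lookup-map i _ xs)) (sym (Vecₚ.lookup-map i _ ys))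
              (nonexp (T.η.at A) _ _ (xs~ys i)))
        }
      }

    module _ (a-η : ∀ x → fun a (fun (T.η.at A) x) A.≈ x)
             (a-μ : ∀ t → fun a (fun (T.μ.at A) t) A.≈ fun a (fun (T.T₁ {T.T₀ A} {A} a) t)) where

      -- Each argument `t` is written as `μ (ηT t)` so that the operation can move past `μ`. Then
      -- `a-μ` trades `μ` for `Ta`, and naturality of the unit turns `Ta (ηT t)` into the generator
      -- on `a t`.
      actionHom : Hom (free A) actionAlgebra
      actionHom = record
        { map = a
        ; preserves = λ f ts → begin
            fun a (fun (op (free A) f) ts)
              ≈⟨ resp a (op-map-id (free A) f (T.μ-ηT {A}) ts) ⟨
            fun a (fun (op (free A) f) (Vec.map (λ t → fun μ (fun ηT t)) ts))
              ≈⟨ resp a (op-map-map (free A) f (fun μ) (fun ηT) ts) ⟨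
            fun a (fun (op (free A) f) (Vec.map (fun μ) (Vec.map (fun ηT) ts)))
              ≈⟨ resp a (Lifting.μ-preserves freeLifting A f _) ⟨
            fun a (fun μ (fun (op (free (T.T₀ A)) f) (Vec.map (fun ηT) ts)))
              ≈⟨ a-μ _ ⟩
            fun a (fun Ta (fun (op (free (T.T₀ A)) f) (Vec.map (fun ηT) ts)))
              ≈⟨ resp a (Lifting.T₁-preserves freeLifting {T.T₀ A} {A} a f _) ⟩
            fun a (fun (op (free A) f) (Vec.map (fun Ta) (Vec.map (fun ηT) ts)))
              ≈⟨ resp a (op-map-map (free A) f (fun Ta) (fun ηT) ts) ⟩
            fun a (fun (op (free A) f) (Vec.map (λ t → fun Ta (fun ηT t)) ts))
              ≈⟨ resp a (op-map-cong (free A) f (T.η.natural {T.T₀ A} {A} a) ts) ⟨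
            fun a (fun (op (free A) f) (Vec.map (λ t → fun (T.η.at A) (fun a t)) ts))
              ≈⟨ resp a (op-map-map (free A) f (fun (T.η.at A)) (fun a) ts) ⟨
            fun a (fun (op (free A) f) (Vec.map (fun (T.η.at A)) (Vec.map (fun a) ts))) ∎
        }
        where
          open SetoidReasoning (setoid (proj₁ A))
          μ = T.μ.at A
          ηT = T.η.at (T.T₀ A)
          Ta = T.T₁ {T.T₀ A} {A} a

      -- The hypotheses of a schema relate variables, so the nonexpansive unit
      -- carries them to the free model, although it is not a homomorphism.
      action-schema : ∀ σ → (∀ φ → Schema.Instance σ φ → Holds U φ) →
                      ∀ φ → Schema.Instance σ φ → actionAlgebra ⊨ φ
      action-schema σ σ⊆U _ inst@(εs , ε , _ , refl) ι hyps =
        A.≼-respˡ (A.≈-sym (eval≈ (Schema.t σ)))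
          (A.≼-respʳ (eval≈ (Schema.s σ))
            (nonexp a _ _ (Lifting.models freeLifting A _ (σ⊆U _ inst) ι′ λ ψ ψ∈ →
              let (i , ψ≡) = ∈-tabulate⁻ ψ∈ in
              subst (λ ψ → Algebra._at_ (free A) ψ ι′) (sym ψ≡)
                (nonexp (T.η.at A) _ _ (hyps _ (∈-tabulate⁺ i))))))
        where
          ι′ = λ v → fun (T.η.at A) (ι v)
          eval≈ : ∀ t → fun a (Algebra.eval (free A) ι′ t) A.≈ Algebra.eval actionAlgebra ι t
          eval≈ t = A.≈-trans (hom-eval actionHom ι′ t)
                              (eval-cong actionAlgebra (λ v → a-η (ι v)) t)

      -- Continuity of `U` enters here: the conditional equations satisfied by `actionAlgebra` form
      -- a theory, so the instances of the axiomatizing schemata suffice.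
      action-models : Models U actionAlgebra
      action-models = Axiomatizes.least axiomatizes (satisfied actionAlgebra)
        λ φ (i , inst) → action-schema (schema i)
          (λ ψ p → Axiomatizes.contains axiomatizes ψ (i , p)) φ inst
        where open IsContinuous c

  -- `Th` is a homomorphism of free algebras sending generators to generators, so equivariance of
  -- `h` passes to the operations. The homomorphisms built from monad maps below rest on this.
  actionAlgebra-hom : ∀ A a B b (h : A CMet.⇒ B) →
    (∀ t → Metric._≈_ (proj₁ B) (fun h (fun a t)) (fun b (fun (T.T₁ {A} {B} h) t))) →
    Hom (actionAlgebra A a) (actionAlgebra B b)
  actionAlgebra-hom A a B b h h-equivariant = record
    { map = h
    ; preserves = λ f xs → begin
        fun h (fun a (fun (op (free A) f) (Vec.map (fun (T.η.at A)) xs)))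
          ≈⟨ h-equivariant _ ⟩
        fun b (fun Th (fun (op (free A) f) (Vec.map (fun (T.η.at A)) xs)))
          ≈⟨ resp b (Lifting.T₁-preserves freeLifting {A} {B} h f _) ⟩
        fun b (fun (op (free B) f) (Vec.map (fun Th) (Vec.map (fun (T.η.at A)) xs)))
          ≈⟨ resp b (op-map-map (free B) f (fun Th) (fun (T.η.at A)) xs) ⟩
        fun b (fun (op (free B) f) (Vec.map (λ x → fun Th (fun (T.η.at A) x)) xs))
          ≈⟨ resp b (op-map-cong (free B) f (T.η.natural {A} {B} h) xs) ⟨
        fun b (fun (op (free B) f) (Vec.map (λ x → fun (T.η.at B) (fun h x)) xs))
          ≈⟨ resp b (op-map-map (free B) f (fun (T.η.at B)) (fun h) xs) ⟨
        fun b (fun (op (free B) f) (Vec.map (fun (T.η.at B)) (Vec.map (fun h) xs))) ∎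
    }
    where
      open SetoidReasoning (setoid (proj₁ B))
      Th = T.T₁ {A} {B} h

  -- From monad maps to liftings.

  module _ {M : Monad CMet} (σ : MonadMap (ℂT U c) M) where
    private
      module M = Monad M
      module σ = MonadMap σ

    -- The free `M`-algebra on `X`, restricted along `σ` to an Eilenberg-Moore algebra of `ℂT U`.
    action : ∀ X → T.T₀ (M.T₀ X) CMet.⇒ M.T₀ X
    action X = CMet._∙_ {T.T₀ (M.T₀ X)} {M.T₀ (M.T₀ X)} {M.T₀ X} (M.μ.at X) (σ.at (M.T₀ X))

    action-η : ∀ X x → Metric._≈_ (proj₁ (M.T₀ X))
      (fun (action X) (fun (T.η.at (M.T₀ X)) x)) x
    action-η X x = Metric.≈-trans (proj₁ (M.T₀ X))
      (resp (M.μ.at X) (σ.resp-unit {M.T₀ X} x)) (M.μ-ηT {X} x)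

    action-μ : ∀ X t → Metric._≈_ (proj₁ (M.T₀ X))
      (fun (action X) (fun (T.μ.at (M.T₀ X)) t))
      (fun (action X) (fun (T.T₁ {T.T₀ (M.T₀ X)} {M.T₀ X} (action X)) t))
    action-μ X t = begin
      fun μ (fun (σ.at MX) (fun (T.μ.at MX) t))
        ≈⟨ resp μ (σ.resp-mult {MX} t) ⟩
      fun μ (fun (M.μ.at MX) (fun (M.T₁ {T.T₀ MX} {M.T₀ MX} (σ.at MX)) (fun (σ.at (T.T₀ MX)) t)))
        ≈⟨ M.μ-assoc {X} _ ⟨
      fun μ (fun (M.T₁ {M.T₀ MX} {MX} μ)
        (fun (M.T₁ {T.T₀ MX} {M.T₀ MX} (σ.at MX)) (fun (σ.at (T.T₀ MX)) t)))
        ≈⟨ resp μ (M.T-∙ {T.T₀ MX} {M.T₀ MX} {MX} _) ⟨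
      fun μ (fun (M.T₁ {T.T₀ MX} {MX} (action X)) (fun (σ.at (T.T₀ MX)) t))
        ≈⟨ resp μ (σ.natural {T.T₀ MX} {MX} (action X) t) ⟨
      fun μ (fun (σ.at MX) (fun (T.T₁ {T.T₀ MX} {MX} (action X)) t)) ∎
      where
        open SetoidReasoning (setoid (proj₁ (M.T₀ X)))
        MX = M.T₀ X
        μ = M.μ.at X

    -- `M.T₁ h` and `M.μ.at X` are maps of free `M`-algebras, hence also commute with the restricted
    -- actions.
    lifting : Lifting U M
    lifting = record
      { ops = λ X → op (actionAlgebra (M.T₀ X) (action X))
      ; models = λ X → action-models (M.T₀ X) (action X) (action-η X) (action-μ X)
      ; T₁-preserves = λ {X} {Y} h → preserves
          (actionAlgebra-hom (M.T₀ X) (action X) (M.T₀ Y) (action Y) (M.T₁ {X} {Y} h)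
            (T₁-equivariant X Y h))
      ; μ-preserves = λ X → preserves
          (actionAlgebra-hom (M.T₀ (M.T₀ X)) (action (M.T₀ X)) (M.T₀ X) (action X) (M.μ.at X)
            (μ-equivariant X))
      }
      where
        T₁-equivariant : ∀ X Y (h : X CMet.⇒ Y) t → Metric._≈_ (proj₁ (M.T₀ Y))
          (fun (M.T₁ {X} {Y} h) (fun (action X) t))
          (fun (action Y) (fun (T.T₁ {M.T₀ X} {M.T₀ Y} (M.T₁ {X} {Y} h)) t))
        T₁-equivariant X Y h t = Metric.≈-trans Y′
          (Metric.≈-sym Y′ (M.μ.natural {X} {Y} h _))
          (resp (M.μ.at Y) (Metric.≈-sym (proj₁ (M.T₀ (M.T₀ Y)))
            (σ.natural {M.T₀ X} {M.T₀ Y} (M.T₁ {X} {Y} h) t)))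
          where Y′ = proj₁ (M.T₀ Y)

        μ-equivariant : ∀ X t → Metric._≈_ (proj₁ (M.T₀ X))
          (fun (M.μ.at X) (fun (action (M.T₀ X)) t))
          (fun (action X) (fun (T.T₁ {M.T₀ (M.T₀ X)} {M.T₀ X} (M.μ.at X)) t))
        μ-equivariant X t = Metric.≈-trans X′
          (Metric.≈-sym X′ (M.μ-assoc {X} _))
          (resp (M.μ.at X) (Metric.≈-sym (proj₁ (M.T₀ (M.T₀ X)))
            (σ.natural {M.T₀ (M.T₀ X)} {M.T₀ X} (M.μ.at X) t)))
          where X′ = proj₁ (M.T₀ X)

    -- By T.μ-ηT, the operations of free X are those given by the action T.μ.at X.
    componentHom : ∀ X → Hom (free X) (Lifting.algebra lifting X)
    componentHom X = record
      { map = σ.at X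
      ; preserves = λ f ts → Metric.≈-trans (proj₁ (M.T₀ X))
          (resp (σ.at X) (begin
            fun (op (free X) f) ts
              ≈⟨ op-map-id (free X) f (T.μ-ηT {X}) ts ⟨
            fun (op (free X) f) (Vec.map (λ t → fun (T.μ.at X) (fun (T.η.at (T.T₀ X)) t)) ts)
              ≈⟨ op-map-map (free X) f _ _ ts ⟨
            fun (op (free X) f) (Vec.map (fun (T.μ.at X)) (Vec.map (fun (T.η.at (T.T₀ X))) ts))
              ≈⟨ Lifting.μ-preserves freeLifting X f _ ⟨
            fun (T.μ.at X) (fun (op (free (T.T₀ X)) f) (Vec.map (fun (T.η.at (T.T₀ X))) ts)) ∎))
          (preserves (actionAlgebra-hom (T.T₀ X) (T.μ.at X) (M.T₀ X) (action X) (σ.at X)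
            equivariant) f ts)
      }
      where
        open SetoidReasoning (setoid (proj₁ (T.T₀ X)))
        equivariant : ∀ t → Metric._≈_ (proj₁ (M.T₀ X))
          (fun (σ.at X) (fun (T.μ.at X) t))
          (fun (action X) (fun (T.T₁ {T.T₀ X} {M.T₀ X} (σ.at X)) t))
        equivariant t = Metric.≈-trans (proj₁ (M.T₀ X)) (σ.resp-mult {X} t)
          (resp (M.μ.at X) (Metric.≈-sym (proj₁ (M.T₀ (M.T₀ X)))
            (σ.natural {T.T₀ X} {M.T₀ X} (σ.at X) t)))

  -- Composites of monad maps, and recovering a lifting from its monad map.

  module _ {W M : Monad CMet} (i : MonadMap (ℂT U c) W) (h : MonadMap W M)
           (k : MonadMap (ℂT U c) M)
           (hi≈k : ∀ X t → Metric._≈_ (proj₁ (Monad.T₀ M X))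
             (fun (MonadMap.at h X) (fun (MonadMap.at i X) t)) (fun (MonadMap.at k X) t)) where
    private
      module W = Monad W
      module M = Monad M
      module i = MonadMap i
      module h = MonadMap h
      module k = MonadMap k

    -- Compatibility of `h` with multiplication makes it equivariant. Keeping `k` apart from the
    -- composite lets the target carry the structure of a prescribed monad map.
    compositeHom : ∀ X → Hom (Lifting.algebra (lifting i) X) (Lifting.algebra (lifting k) X)
    compositeHom X = actionAlgebra-hom (W.T₀ X) (action i X) (M.T₀ X) (action k X) (h.at X) λ t → begin
      fun (h.at X) (fun (W.μ.at X) (fun (i.at (W.T₀ X)) t))
        ≈⟨ h.resp-mult {X} _ ⟩
      fun (M.μ.at X) (fun Mh (fun (h.at (W.T₀ X)) (fun (i.at (W.T₀ X)) t)))
        ≈⟨ resp (M.μ.at X) (resp Mh (hi≈k (W.T₀ X) t)) ⟩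
      fun (M.μ.at X) (fun Mh (fun (k.at (W.T₀ X)) t))
        ≈⟨ resp (M.μ.at X) (k.natural {W.T₀ X} {M.T₀ X} (h.at X) t) ⟨
      fun (M.μ.at X) (fun (k.at (M.T₀ X)) (fun (T.T₁ {W.T₀ X} {M.T₀ X} (h.at X)) t)) ∎
      where
        open SetoidReasoning (setoid (proj₁ (M.T₀ X)))
        Mh = M.T₁ {W.T₀ X} {M.T₀ X} (h.at X)

  -- One round trip of the correspondence. The induced homomorphism takes generators to `M.η`, then
  -- `μ` passes through the operation and cancels against `M.η` in each argument.
  lifting-induced : ∀ {M : Monad CMet} (l : Lifting U M) X f as →
    Metric._≈_ (proj₁ (Monad.T₀ M X))
      (fun (Lifting.ops (lifting (induced l)) X f) as) (fun (Lifting.ops l X f) as)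
  lifting-induced {M} l X f as = begin
    fun μ (fun σ (fun (op (free MX) f) (Vec.map (fun (T.η.at MX)) as)))
      ≈⟨ resp μ (preserves (inducedHom l MX) f _) ⟩
    fun μ (fun (op (algebra MX) f) (Vec.map (fun σ) (Vec.map (fun (T.η.at MX)) as)))
      ≈⟨ resp μ (op-map-map (algebra MX) f (fun σ) (fun (T.η.at MX)) as) ⟩
    fun μ (fun (op (algebra MX) f) (Vec.map (λ x → fun σ (fun (T.η.at MX) x)) as))
      ≈⟨ resp μ (op-map-cong (algebra MX) f (induced-η l MX) as) ⟩
    fun μ (fun (op (algebra MX) f) (Vec.map (fun (M.η.at MX)) as))
      ≈⟨ μ-preserves X f _ ⟩
    fun (op (algebra X) f) (Vec.map (fun μ) (Vec.map (fun (M.η.at MX)) as))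
      ≈⟨ op-map-map (algebra X) f (fun μ) (fun (M.η.at MX)) as ⟩
    fun (op (algebra X) f) (Vec.map (λ x → fun μ (fun (M.η.at MX) x)) as)
      ≈⟨ op-map-id (algebra X) f (M.μ-ηT {X}) as ⟩
    fun (op (algebra X) f) as ∎
    where
      open Lifting l
      module M = Monad M
      open SetoidReasoning (setoid (proj₁ (M.T₀ X)))
      MX = M.T₀ X
      μ = M.μ.at X
      σ = map (inducedHom l MX)

  -- This is `compositeHom` with `lifting (induced l)` replaced by `l`, the form in which the free
  -- models of the sum theory supply their operations.
  inducedCompositeHom : ∀ {W M : Monad CMet} (l : Lifting U W) (h : MonadMap W M)
    (k : MonadMap (ℂT U c) M) →
    (∀ X t → Metric._≈_ (proj₁ (Monad.T₀ M X))
      (fun (MonadMap.at h X) (fun (map (inducedHom l X)) t)) (fun (MonadMap.at k X) t)) →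
    ∀ X → Hom (Lifting.algebra l X) (Lifting.algebra (lifting k) X)
  inducedCompositeHom {W} {M} l h k hi≈k X = record
    { map = MonadMap.at h X
    ; preserves = λ f as → Metric.≈-trans (proj₁ (Monad.T₀ M X))
        (resp (MonadMap.at h X)
          (Metric.≈-sym (proj₁ (Monad.T₀ W X)) (lifting-induced l X f as)))
        (preserves (compositeHom {W} {M} (induced l) h k hi≈k X) f as)
    }

-- The coproduct of the two monads.

module _ {S S′ : Signature} (U : Theory S) (U′ : Theory S′)
         (c : IsContinuous U) (c′ : IsContinuous U′) where
  private
    c+c′ : IsContinuous (U +ₜ U′)
    c+c′ = +ₜ-continuous c c′

    module F  = Induced U c
    module F′ = Induced U′ c′
    module F+ = Induced (U +ₜ U′) c+c′

    ℂT+ : Monad CMet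
    ℂT+ = ℂT (U +ₜ U′) c+c′

    l₁ : Lifting U ℂT+
    l₁ = restrict₁ {U = U} {U′} F+.freeLifting
    l₂ : Lifting U′ ℂT+
    l₂ = restrict₂ {U = U} {U′} F+.freeLifting

    module _ {M : Monad CMet} (f : MonadMap (ℂT U c) M) (g : MonadMap (ℂT U′ c′) M) where
      private
        module M = Monad M
        module f = MonadMap f
        module g = MonadMap g

      l₊ : Lifting (U +ₜ U′) M
      l₊ = combine (F.lifting f) (F′.lifting g)

      copair : MonadMap ℂT+ M
      copair = F+.induced l₊

      -- Both sides are `S`-homomorphisms from a free model of `U` and restrict to `M.η` on
      -- generators.
      copair₁ : ∀ X t → Metric._≈_ (proj₁ (M.T₀ X))
        (fun (MonadMap.at copair X) (fun (map (F.inducedHom l₁ X)) t)) (fun (f.at X) t)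
      copair₁ X = F.free-unique X
        ((Lifting.algebra l X , Lifting.models l X) , proj₂ (M.T₀ X))
        -- The `S`-reduct of the algebra of `l₊` is definitionally that of `F.lifting f`, so both
        -- homomorphisms have the same target.
        (reductHom₁ (F+.inducedHom l₊ X) ∘ₕ F.inducedHom l₁ X) (F.componentHom f X)
        λ x → M′.≈-trans (resp (MonadMap.at copair X) (F.induced-η l₁ X x))
          (M′.≈-trans (F+.induced-η l₊ X x) (M′.≈-sym (f.resp-unit {X} x)))
        where
          l = F.lifting f
          module M′ = Metric (proj₁ (M.T₀ X))

      copair₂ : ∀ X t → Metric._≈_ (proj₁ (M.T₀ X))
        (fun (MonadMap.at copair X) (fun (map (F′.inducedHom l₂ X)) t)) (fun (g.at X) t)
      copair₂ X = F′.free-unique X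
        ((Lifting.algebra l X , Lifting.models l X) , proj₂ (M.T₀ X))
        (reductHom₂ (F+.inducedHom l₊ X) ∘ₕ F′.inducedHom l₂ X) (F′.componentHom g X)
        λ x → M′.≈-trans (resp (MonadMap.at copair X) (F′.induced-η l₂ X x))
          (M′.≈-trans (F+.induced-η l₊ X x) (M′.≈-sym (g.resp-unit {X} x)))
        where
          l = F′.lifting g
          module M′ = Metric (proj₁ (M.T₀ X))

      -- The first equation makes `h` preserve the operations of `S`, the second those of `S′`. It
      -- is then a homomorphism for `l₊` extending `M.η`, and freeness over the sum theory
      -- determines it.
      copair-unique : (h : MonadMap ℂT+ M) →
        (∀ X t → Metric._≈_ (proj₁ (M.T₀ X))
          (fun (MonadMap.at h X) (fun (map (F.inducedHom l₁ X)) t)) (fun (f.at X) t)) →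
        (∀ X t → Metric._≈_ (proj₁ (M.T₀ X))
          (fun (MonadMap.at h X) (fun (map (F′.inducedHom l₂ X)) t)) (fun (g.at X) t)) →
        ∀ X t → Metric._≈_ (proj₁ (M.T₀ X))
          (fun (MonadMap.at h X) t) (fun (MonadMap.at copair X) t)
      copair-unique h hi₁≈f hi₂≈g X = F+.induced-unique l₊ X
        (record { map = MonadMap.at h X ; preserves = λ where
          (inj₁ o) → preserves (F.inducedCompositeHom l₁ h f hi₁≈f X) o
          (inj₂ o) → preserves (F′.inducedCompositeHom l₂ h g hi₂≈g X) o })
        (MonadMap.resp-unit h {X})

  sumCoproduct : Coproduct (Monads CMet) (ℂT U c) (ℂT U′ c′)
  sumCoproduct = record
    { obj = ℂT+
    ; i₁ = F.induced l₁
    ; i₂ = F′.induced l₂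
    ; [_,_] = copair
    ; inject₁ = λ {_} {f} {g} → copair₁ f g
    ; inject₂ = λ {_} {f} {g} → copair₂ f g
    ; unique = λ {_} {f} {g} {h} → copair-unique f g h
    }

theorem5p4 : ∀ {S S′ : Signature} (U : Theory S) (U′ : Theory S′)
    (c : IsContinuous U) (c′ : IsContinuous U′) →
    Σ (Coproduct (Monads CMet) (ℂT U c) (ℂT U′ c′)) λ ℂT+ℂT′ →
    Isomorphic (Monads CMet) (ℂT (U +ₜ U′) (+ₜ-continuous c c′)) (Coproduct.obj ℂT+ℂT′)
-- The coproduct is carried by `ℂT+` itself, so identities give the isomorphism.
theorem5p4 U U′ c c′ = sumCoproduct U U′ c c′ , record
  { to = Monads.id {ℂT+} ; from = Monads.id {ℂT+}
  ; to∙from = Monads.identityˡ {ℂT+} {ℂT+} {Monads.id {ℂT+}}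
  ; from∙to = Monads.identityˡ {ℂT+} {ℂT+} {Monads.id {ℂT+}}
  }
  where
    module Monads = Category (Monads CMet)
    ℂT+ = ℂT (U +ₜ U′) (+ₜ-continuous c c′)
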